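{- For all nonnegative integers $r_1,r_2$ and all integers $n\ge r_1+r_2+2$, \begin{align*} &\sum_{k=1}^{2n-1}\frac{B_k}{k!}\frac{B_{2n-k}}{(2n-k)!}\prod_{a=1}^{r_1}(k-a)\prod_{b=1}^{r_2}(2n-k-b) =\sum_{k=r_1+1}^{2n-r_2-1}\frac{B_k}{k!}\frac{B_{2n-k}}{(2n-k)!}\prod_{a=1}^{r_1}(k-a)\prod_{b=1}^{r_2}(2n-k-b)\\ &=-r_1!\,r_2!\left(\binom{2n-1}{r_1+r_2+1}+\mathop{\mathrm{Cyc}}_{r_1,r_2}(-1)^{r_2}\binom{2n-1}{r_1}\right)\frac{B_{2n}}{(2n)!}\\ &\quad-r_1!\,r_2!\,\mathop{\mathrm{Cyc}}_{r_1,r_2}(-1)^{r_1}\sum_{k=r_1+1}^{r_1+r_2+1}\binom{2n-1-k}{r_1+r_2+1-k}\binom{k-1}{r_1}\frac{B_k}{k!}\frac{B_{2n-k}}{(2n-k)!}. \end{align*}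
   Context: The Bernoulli numbers $B_j$ are defined by $\frac{t}{e^t-1}=\sum_{j\ge0}B_j\frac{t^j}{j!}$ (so $B_1=-1/2$). Empty products equal $1$. For any expression $f(r_1,r_2)$, $\mathop{\mathrm{Cyc}}_{r_1,r_2} f(r_1,r_2)=f(r_1,r_2)+f(r_2,r_1)$ (roles of $r_1,r_2$ interchanged everywhere, including summation limits). Binomial coefficients $\binom{a}{b}$ vanish for $b<0$ or $b>a$. -}

module Defs where

open import Data.Nat as ℕ using (ℕ; zero; suc; _∸_; _!)
open import Data.Nat.Properties using (_!≢0)
open import Data.Integer as ℤ using (ℤ; +_)
open import Data.Rational using (ℚ; 0ℚ; 1ℚ; _+_; _*_; -_; _/_)
open import Data.List using (List; []; _∷_)

inv! : ℕ → ℚ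
inv! m = _/_ (+ 1) (m !) {{m !≢0}}

_÷!_ : ℚ → ℕ → ℚ
x ÷! m = x * inv! m
infixl 7 _÷!_

ℕ→ℚ : ℕ → ℚ
ℕ→ℚ n = (+ n) / 1

ℤ→ℚ : ℤ → ℚ
ℤ→ℚ z = z / 1

sumBelow : ℕ → (ℕ → ℚ) → ℚ
sumBelow zero    f = 0ℚ
sumBelow (suc n) f = sumBelow n f + f n

-- Σ_{k=lo}^{hi} f k   (empty, i.e. 0, when hi < lo)
sumFromTo : ℕ → ℕ → (ℕ → ℚ) → ℚ
sumFromTo lo hi f = sumBelow (suc hi ∸ lo) (λ i → f (lo ℕ.+ i))

prod1To : ℕ → (ℕ → ℚ) → ℚ
prod1To zero    f = 1ℚ
prod1To (suc r) f = prod1To r f * f (suc r)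

signPow : ℕ → ℚ
signPow zero    = 1ℚ
signPow (suc r) = - signPow r

Cyc : (ℕ → ℕ → ℚ) → ℕ → ℕ → ℚ
Cyc f r₁ r₂ = f r₁ r₂ + f r₂ r₁

-- Bernoulli numbers via the generating function t/(e^t - 1) = Σ B_j t^j / j!.
-- Writing c_j = B_j / j!, the identity (Σ_j c_j t^j) · ((e^t - 1)/t) = 1 with
-- (e^t-1)/t = Σ_i t^i/(i+1)! gives, comparing coefficients of t^m:
--   c_0 = 1,   c_m = - Σ_{j<m} c_j / (m-j+1)!   (m ≥ 1).
-- bernList m = [c_m, c_{m-1}, ..., c_0].
private
  step : ℕ → List ℚ → ℚ
  step i []       = 0ℚ
  step i (x ∷ xs) = x ÷! (suc (suc i)) + step (suc i) xs

bernList : ℕ → List ℚ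
bernList zero    = 1ℚ ∷ []
bernList (suc m) = (- step 0 (bernList m)) ∷ bernList m

bernCoeff : ℕ → ℚ
bernCoeff m with bernList m
... | []     = 0ℚ
... | x ∷ _  = x

-- Bernoulli number B_m (B_1 = -1/2)
B : ℕ → ℚ
B m = ℕ→ℚ (m !) * bernCoeff m

{-# OPTIONS --safe #-}

-- Write c k = B k / k!, so that c(t) = Σ c k tᵏ satisfies eᵗ c(t) = c(t) + t.  From eʸᵗ eᶻᵗ = e⁽ʸ⁺ᶻ⁾ᵗ one gets
--   (y + z) c(yt) c(zt) = z c(yt) c((y+z)t) + y c(zt) c((y+z)t) + y z t c((y+z)t).
-- For y = 1, z = -1 this is c(-t) = c(t) + t, so c k = 0 for odd k ≥ 3.  For y = 1, z = w an indeterminate,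
-- dividing by 1 + w and comparing coefficients of t^(2n) w^(r₂+1) gives the theorem for r₁ = 0.
--
-- Since (k-1)⋯(k-r) = r! (k-1 choose r), the theorem concerns Σ (k-1 choose a) (2n-k-1 choose b) c k c (2n-k).
-- With M = 2n - 2, this sum and every term on the right-hand side (divided by r₁! r₂!) satisfy
--   (M - a - b) Ψ a b = (a + 1) Ψ (a+1) b + (b + 1) Ψ a (b+1)
-- (the Leibniz rule for products of derivatives of 1/(eᵗ - 1)), so the case a = 0 implies all others.

module Submission where

open import Algebra using (CommutativeRing)
import Algebra.Properties.Ring as RingProperties
import Algebra.Properties.Semiring.Exp as Exp
import Algebra.Solver.Ring.NaturalCoefficients.Default as NatSolver
open import Data.Nat as ℕ using (ℕ; _≤_; _∸_; _!; zero; suc; _<_; z≤n; s≤s)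
open import Data.Product using (_×_; _,_)
open import Level using (0ℓ)

-- Formal power series

-- Taking z = w as an indeterminate means working with coefficients in ℚ[[w]]. Power series are
-- therefore developed over an arbitrary commutative ring and used twice, over ℚ and over ℚ[[w]]; in
-- the latter 1 + w is a unit, with inverse Σ (-w)ʲ, so the division by it is legitimate. The terms
-- with c (2n) come from the two ends k = 0 and k = 2n of the convolutions, which the sum of the
-- theorem omits. Parity enters only in the case r₁ = 0. With b = r₂, comparing coefficients leaves
-- (1 + (-1)ᵇ) c (b+1) c (M+1-b) and a multiple of c (M+1) over; both vanish because c k = 0 for odd
-- k ≥ 3. The recurrence is applied to the difference of the two sides. It is linear, and it can be
-- solved for Ψ (a+1) b because a + 1 is invertible, so a difference that is zero on the row a = 0
-- stays zero on all later rows as long as a + b < M.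

module PowerSeries (R : CommutativeRing 0ℓ 0ℓ) where
  open CommutativeRing R
  open import Relation.Binary.Reasoning.Setoid setoid
  open Exp semiring using (_^_)
  open NatSolver commutativeSemiring using (solve; _:+_; _:*_; _:=_)

  Series : Set
  Series = ℕ → Carrier

  infix  4 _≋_
  infixl 6 _⊕_
  infixl 7 _⊛_ _·_

  _≋_ : Series → Series → Set
  f ≋ g = ∀ n → f n ≈ g n

  tail : Series → Series
  tail f n = f (suc n)

  _⊕_ : Series → Series → Series
  (f ⊕ g) n = f n + g n

  _·_ : Carrier → Series → Series
  (a · f) n = a * f n

  -- The Cauchy product, by recursion on the degree through f g = f 0 g + t (tail f) g. No range of
  -- summation or truncated subtraction occurs, so the ring laws follow by induction on the degree.
  _⊛_ : Series → Series → Series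
  (f ⊛ g) zero    = f 0 * g 0
  (f ⊛ g) (suc n) = f 0 * g (suc n) + (tail f ⊛ g) n

  const : Carrier → Series
  const a zero    = a
  const a (suc n) = 0#

  X : Series
  X (suc zero) = 1#
  X _          = 0#

  ⊛-cong : ∀ {f f′ g g′} → f ≋ f′ → g ≋ g′ → f ⊛ g ≋ f′ ⊛ g′
  ⊛-cong p q zero    = *-cong (p 0) (q 0)
  ⊛-cong p q (suc n) = +-cong (*-cong (p 0) (q (suc n))) (⊛-cong (λ k → p (suc k)) q n)

  ⊛-distribʳ : ∀ h f g → (f ⊕ g) ⊛ h ≋ f ⊛ h ⊕ g ⊛ h
  ⊛-distribʳ h f g zero    = distribʳ _ _ _
  ⊛-distribʳ h f g (suc n) = trans (+-congˡ (⊛-distribʳ h (tail f) (tail g) n))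
    (solve 5 (λ a b c x y → (a :+ b) :* c :+ (x :+ y) := (a :* c :+ x) :+ (b :* c :+ y))
      refl (f 0) (g 0) (h (suc n)) ((tail f ⊛ h) n) ((tail g ⊛ h) n))

  ·-⊛-assoc : ∀ a f g → (a · f) ⊛ g ≋ a · (f ⊛ g)
  ·-⊛-assoc a f g zero    = *-assoc _ _ _
  ·-⊛-assoc a f g (suc n) = trans (+-congˡ (·-⊛-assoc a (tail f) g n))
    (solve 4 (λ a b c x → (a :* b) :* c :+ a :* x := a :* (b :* c :+ x))
      refl a (f 0) (g (suc n)) ((tail f ⊛ g) n))

  -- The mirror image of the defining recursion, consuming the right factor; commutativity rests on
  -- it.
  ⊛-suc : ∀ f g n → (f ⊛ g) (suc n) ≈ f (suc n) * g 0 + (f ⊛ tail g) n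
  ⊛-suc f g zero    = +-comm _ _
  ⊛-suc f g (suc n) = trans (+-congˡ (⊛-suc (tail f) g n))
    (solve 3 (λ a b c → a :+ (b :+ c) := b :+ (a :+ c)) refl
      (f 0 * g (suc (suc n))) (f (suc (suc n)) * g 0) ((tail f ⊛ tail g) n))

  ⊛-ends : ∀ f g n → (f ⊛ g) (suc (suc n)) ≈
    f 0 * g (suc (suc n)) + f (suc (suc n)) * g 0 + (tail f ⊛ tail g) n
  ⊛-ends f g n = trans (+-congˡ (⊛-suc (tail f) g n)) (sym (+-assoc _ _ _))

  ⊛-comm : ∀ f g → f ⊛ g ≋ g ⊛ f
  ⊛-comm f g zero    = *-comm _ _
  ⊛-comm f g (suc n) =
    trans (+-cong (*-comm _ _) (⊛-comm (tail f) g n)) (sym (⊛-suc g f n))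

  ⊛-assoc : ∀ f g h → (f ⊛ g) ⊛ h ≋ f ⊛ (g ⊛ h)
  ⊛-assoc f g h zero    = *-assoc _ _ _
  ⊛-assoc f g h (suc n) = begin
    -- By definition `tail (f ⊛ g)` is `f 0 · tail g ⊕ tail f ⊛ g`.
    f 0 * g 0 * h (suc n) + ((f 0 · tail g ⊕ tail f ⊛ g) ⊛ h) n
      ≈⟨ +-congˡ (⊛-distribʳ h (f 0 · tail g) (tail f ⊛ g) n) ⟩
    f 0 * g 0 * h (suc n) + (((f 0 · tail g) ⊛ h) n + ((tail f ⊛ g) ⊛ h) n)
      ≈⟨ +-congˡ (+-cong (·-⊛-assoc (f 0) (tail g) h n) (⊛-assoc (tail f) g h n)) ⟩
    f 0 * g 0 * h (suc n) + (f 0 * (tail g ⊛ h) n + (tail f ⊛ (g ⊛ h)) n)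
      ≈⟨ solve 5 (λ a b c x y → (a :* b) :* c :+ (a :* x :+ y) := a :* (b :* c :+ x) :+ y)
           refl (f 0) (g 0) (h (suc n)) ((tail g ⊛ h) n) ((tail f ⊛ (g ⊛ h)) n) ⟩
    f 0 * (g ⊛ h) (suc n) + (tail f ⊛ (g ⊛ h)) n ∎

  0⊛ : ∀ f → (λ _ → 0#) ⊛ f ≋ (λ _ → 0#)
  0⊛ f zero    = zeroˡ _
  0⊛ f (suc n) = trans (+-cong (zeroˡ _) (0⊛ f n)) (+-identityˡ _)

  const-⊛ : ∀ a f → const a ⊛ f ≋ a · f
  const-⊛ a f zero    = refl
  const-⊛ a f (suc n) = trans (+-congˡ (0⊛ f n)) (+-identityʳ _)

  1⊛ : ∀ f → const 1# ⊛ f ≋ f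
  1⊛ f n = trans (const-⊛ 1# f n) (*-identityˡ _)

  commutativeRing-⊛ : CommutativeRing 0ℓ 0ℓ
  commutativeRing-⊛ = record
    { Carrier = Series ; _≈_ = _≋_ ; _+_ = _⊕_ ; _*_ = _⊛_
    ; -_ = λ f n → - f n ; 0# = λ _ → 0# ; 1# = const 1#
    ; isCommutativeRing = record
      { isRing = record
        { +-isAbelianGroup = record
          { isGroup = record
            { isMonoid = record
              { isSemigroup = record
                { isMagma = record
                  { isEquivalence = record
                    { refl = λ _ → refl ; sym = λ p n → sym (p n)
                    ; trans = λ p q n → trans (p n) (q n) }
                  ; ∙-cong = λ p q n → +-cong (p n) (q n) }
                ; assoc = λ f g h n → +-assoc _ _ _ }
              ; identity = (λ f n → +-identityˡ _) , (λ f n → +-identityʳ _) }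
            ; inverse = (λ f n → -‿inverseˡ _) , (λ f n → -‿inverseʳ _)
            ; ⁻¹-cong = λ p n → -‿cong (p n) }
          ; comm = λ f g n → +-comm _ _ }
        ; *-cong = ⊛-cong
        ; *-assoc = ⊛-assoc
        ; *-identity = 1⊛ , (λ f n → trans (⊛-comm f (const 1#) n) (1⊛ f n))
        ; distrib = (λ f g h n → trans (⊛-comm f (g ⊕ h) n) (trans (⊛-distribʳ f g h n)
                      (+-cong (⊛-comm g f n) (⊛-comm h f n)))) , ⊛-distribʳ }
      ; *-comm = ⊛-comm } }

  X⊛-zero : ∀ f → (X ⊛ f) 0 ≈ 0#
  X⊛-zero f = zeroˡ _

  X⊛-suc : ∀ f n → (X ⊛ f) (suc n) ≈ f n
  X⊛-suc f n = trans (+-cong (zeroˡ _) (⊛-cong tailX (λ _ → refl) n))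
    (trans (+-identityˡ _) (1⊛ f n))
    where
    tailX : tail X ≋ const 1#
    tailX zero    = refl
    tailX (suc _) = refl

  X⊛-cancel : ∀ f g → X ⊛ f ≋ X ⊛ g → f ≋ g
  X⊛-cancel f g p n = trans (sym (X⊛-suc f n)) (trans (p (suc n)) (X⊛-suc g n))

  const-* : ∀ a b → const (a * b) ≋ const a ⊛ const b
  const-* a b zero    = refl
  const-* a b (suc n) = sym (trans (const-⊛ a (const b) (suc n)) (zeroʳ a))

  const-+ : ∀ a b → const (a + b) ≋ const a ⊕ const b
  const-+ a b zero    = refl
  const-+ a b (suc n) = sym (+-identityˡ 0#)

  -- The substitution t ↦ y t, so that `scale y e` is exp (y t).
  scale : Carrier → Series → Series
  scale y f n = y ^ n * f n

  scale-⊛ : ∀ y f g → scale y (f ⊛ g) ≋ scale y f ⊛ scale y g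
  scale-⊛ y f g zero    =
    trans (*-identityˡ _) (sym (*-cong (*-identityˡ (f 0)) (*-identityˡ (g 0))))
  scale-⊛ y f g (suc n) = sym (begin
    1# * f 0 * (y * y ^ n * g (suc n)) + (tail (scale y f) ⊛ scale y g) n
      ≈⟨ +-cong (*-congʳ (*-identityˡ (f 0))) tail-scale ⟩
    f 0 * (y * y ^ n * g (suc n)) + y * (y ^ n * (tail f ⊛ g) n)
      ≈⟨ solve 5 (λ a u v b p → a :* (u :* v :* b) :+ u :* (v :* p) := u :* v :* (a :* b :+ p))
           refl (f 0) y (y ^ n) (g (suc n)) ((tail f ⊛ g) n) ⟩
    y * y ^ n * (f 0 * g (suc n) + (tail f ⊛ g) n) ∎)
    where
    tail-scale : (tail (scale y f) ⊛ scale y g) n ≈ y * (y ^ n * (tail f ⊛ g) n)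
    tail-scale = begin
      (tail (scale y f) ⊛ scale y g) n
        ≈⟨ ⊛-cong (λ k → *-assoc y (y ^ k) (f (suc k))) (λ _ → refl) n ⟩
      ((y · scale y (tail f)) ⊛ scale y g) n
        ≈⟨ ·-⊛-assoc y (scale y (tail f)) (scale y g) n ⟩
      y * (scale y (tail f) ⊛ scale y g) n
        ≈⟨ *-congˡ (scale-⊛ y (tail f) g n) ⟨
      y * (y ^ n * (tail f ⊛ g) n) ∎

  scale-1 : ∀ f → scale 1# f ≋ f
  scale-1 f n = trans (*-congʳ (1^ n)) (*-identityˡ _)
    where
    1^ : ∀ n → 1# ^ n ≈ 1#
    1^ zero    = refl
    1^ (suc n) = trans (*-identityˡ _) (1^ n)

  scale-X : ∀ y → scale y X ≋ const y ⊛ X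
  scale-X y n = trans (lemma n) (sym (const-⊛ y X n))
    where
    lemma : scale y X ≋ y · X
    lemma zero          = trans (zeroʳ _) (sym (zeroʳ _))
    lemma (suc zero)    = *-congʳ (*-identityʳ y)
    lemma (suc (suc n)) = trans (zeroʳ _) (sym (zeroʳ _))

  fromℕ : ℕ → Carrier
  fromℕ zero    = 0#
  fromℕ (suc n) = 1# + fromℕ n

  -- The Euler derivation t d/dt; unlike d/dt it preserves degrees.
  ϑ : Series → Series
  ϑ f n = fromℕ n * f n

  ϑ-⊛ : ∀ f g → ϑ (f ⊛ g) ≋ ϑ f ⊛ g ⊕ f ⊛ ϑ g
  ϑ-⊛ f g zero    = begin
    0# * (f 0 * g 0)                      ≈⟨ zeroˡ _ ⟩
    0#                                    ≈⟨ +-identityˡ 0# ⟨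
    0# + 0#                               ≈⟨ +-cong (trans (*-congʳ (zeroˡ _)) (zeroˡ _)) (trans
         (*-congˡ (zeroˡ _)) (zeroʳ _)) ⟨
    0# * f 0 * g 0 + f 0 * (0# * g 0)     ∎
  ϑ-⊛ f g (suc n) = begin
    (1# + fromℕ n) * (f 0 * g (suc n) + (tail f ⊛ g) n)
      ≈⟨ solve 5 (λ i m a b p → (i :+ m) :* (a :* b :+ p) := i :* p :+ m :* p :+ a :* ((i :+ m) :* b))
           refl 1# (fromℕ n) (f 0) (g (suc n)) ((tail f ⊛ g) n) ⟩
    1# * (tail f ⊛ g) n + ϑ (tail f ⊛ g) n + f 0 * ϑ g (suc n)
      ≈⟨ +-congʳ (+-cong (*-identityˡ _) (ϑ-⊛ (tail f) g n)) ⟩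
    (tail f ⊛ g) n + ((ϑ (tail f) ⊛ g) n + (tail f ⊛ ϑ g) n) + f 0 * ϑ g (suc n)
      ≈⟨ solve 4 (λ a b c d → a :+ (b :+ c) :+ d := (a :+ b) :+ (d :+ c)) refl
           ((tail f ⊛ g) n) ((ϑ (tail f) ⊛ g) n) ((tail f ⊛ ϑ g) n) (f 0 * ϑ g (suc n)) ⟩
    (tail f ⊛ g) n + (ϑ (tail f) ⊛ g) n + (f ⊛ ϑ g) (suc n)
      ≈⟨ +-congʳ (⊛-distribʳ g (tail f) (ϑ (tail f)) n) ⟨
    ((tail f ⊕ ϑ (tail f)) ⊛ g) n + (f ⊛ ϑ g) (suc n)
      ≈⟨ +-congʳ (trans (+-cong (trans (*-congʳ (zeroˡ _)) (zeroˡ _)) (⊛-cong tail-ϑ (λ _ → refl) n))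
           (+-identityˡ _)) ⟨
    (ϑ f ⊛ g) (suc n) + (f ⊛ ϑ g) (suc n) ∎
    where
    tail-ϑ : tail (ϑ f) ≋ tail f ⊕ ϑ (tail f)
    tail-ϑ k = trans (distribʳ _ _ _) (+-congʳ (*-identityˡ _))

-- Functional equations of the Bernoulli generating series

module BernoulliSeries (R : CommutativeRing 0ℓ 0ℓ) where
  open CommutativeRing R
  open PowerSeries R
  open Exp semiring using (_^_)
  open import Relation.Binary.Reasoning.Setoid setoid
  open NatSolver commutativeSemiring using (solve; _:+_; _:*_; _:=_)
  open RingProperties ring using (-1*x≈-x)

  private
    module P where
      open CommutativeRing commutativeRing-⊛ public
      open NatSolver (CommutativeRing.commutativeSemiring commutativeRing-⊛) public
        using (solve; _:+_; _:*_; _:=_)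
      open RingProperties (CommutativeRing.ring commutativeRing-⊛) public using (+-cancelˡ)

  -- The first two assumptions make R a ℚ-algebra; the next ones characterise e as the exponential
  -- series, and `e-c` is the equation of the Bernoulli series. Stated this way, they can be met
  -- both in ℚ and in ℚ[[w]].
  module _ (recip : ℕ → Carrier) (recip-inverse : ∀ n → recip n * fromℕ (suc n) ≈ 1#)
           (e c : Series) (e-zero : e 0 ≈ 1#) (e-suc : ∀ n → fromℕ (suc n) * e (suc n) ≈ e n)
           (e-c : e ⊛ c ≋ c ⊕ X) where

    -- The differential equation t f′ = y t f reads (n+1) f (n+1) = y f n on coefficients, and n + 1
    -- is invertible.
    ϑ-unique : ∀ y f g → ϑ f ≋ const y ⊛ (X ⊛ f) → ϑ g ≋ const y ⊛ (X ⊛ g) → f 0 ≈ g 0 → f ≋ g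
    ϑ-unique y f g p q r zero    = r
    ϑ-unique y f g p q r (suc n) = begin
      f (suc n)                                ≈⟨ normalise f p ⟩
      recip n * (y * f n)                      ≈⟨ *-congˡ (*-congˡ (ϑ-unique y f g p q r n)) ⟩
      recip n * (y * g n)                      ≈⟨ normalise g q ⟨
      g (suc n)                                ∎
      where
      normalise : ∀ h → ϑ h ≋ const y ⊛ (X ⊛ h) → h (suc n) ≈ recip n * (y * h n)
      normalise h s = begin
        h (suc n)                              ≈⟨ *-identityˡ _ ⟨
        1# * h (suc n)                         ≈⟨ *-congʳ (recip-inverse n) ⟨
        recip n * fromℕ (suc n) * h (suc n)    ≈⟨ *-assoc _ _ _ ⟩
        recip n * ϑ h (suc n)                  ≈⟨ *-congˡ (s (suc n)) ⟩
        recip n * (const y ⊛ (X ⊛ h)) (suc n)  ≈⟨ *-congˡ (trans (const-⊛ y (X ⊛ h) (suc n)) (*-congˡ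
             (X⊛-suc h n))) ⟩
        recip n * (y * h n)                    ∎

    ϑ-scale-e : ∀ y → ϑ (scale y e) ≋ const y ⊛ (X ⊛ scale y e)
    ϑ-scale-e y zero    = trans (zeroˡ _) (sym (trans (*-congˡ (X⊛-zero (scale y e))) (zeroʳ _)))
    ϑ-scale-e y (suc n) = begin
      fromℕ (suc n) * (y * y ^ n * e (suc n))
        ≈⟨ solve 4 (λ a u v b → a :* (u :* v :* b) := u :* (v :* (a :* b))) refl
             (fromℕ (suc n)) y (y ^ n) (e (suc n)) ⟩
      y * (y ^ n * (fromℕ (suc n) * e (suc n)))  ≈⟨ *-congˡ (*-congˡ (e-suc n)) ⟩
      y * scale y e n                            ≈⟨ *-congˡ (X⊛-suc (scale y e) n) ⟨
      y * (X ⊛ scale y e) (suc n)                ≈⟨ const-⊛ y (X ⊛ scale y e) (suc n) ⟨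
      (const y ⊛ (X ⊛ scale y e)) (suc n)        ∎

    -- Both sides solve t f′ = (y + z) t f with constant term 1, which replaces an appeal to the
    -- binomial theorem.
    scale-e-⊛ : ∀ y z → scale y e ⊛ scale z e ≋ scale (y + z) e
    scale-e-⊛ y z = ϑ-unique (y + z) _ _ product (ϑ-scale-e (y + z)) ends
      where
      u v : Series
      u = scale y e
      v = scale z e

      product : ϑ (u ⊛ v) ≋ const (y + z) ⊛ (X ⊛ (u ⊛ v))
      product = P.trans (ϑ-⊛ u v) (P.trans
        (P.+-cong (⊛-cong (ϑ-scale-e y) (λ _ → refl)) (⊛-cong (P.refl {u}) (ϑ-scale-e z)))
        (P.trans (P.solve 5 (λ a b x u v → (a P.:* (x P.:* u)) P.:* v P.:+ u P.:* (b P.:* (x P.:* v))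
                     P.:= (a P.:+ b) P.:* (x P.:* (u P.:* v))) P.refl (const y) (const z) X u v)
          (⊛-cong (P.sym (const-+ y z)) (P.refl {X ⊛ (u ⊛ v)}))))

      ends : 1# * e 0 * (1# * e 0) ≈ 1# * e 0
      ends = trans (*-congˡ (trans (*-identityˡ _) e-zero)) (*-identityʳ _)

    scale-e-c : ∀ y → scale y e ⊛ scale y c ≋ scale y c ⊕ const y ⊛ X
    scale-e-c y n = begin
      (scale y e ⊛ scale y c) n        ≈⟨ scale-⊛ y e c n ⟨
      y ^ n * (e ⊛ c) n                ≈⟨ *-congˡ (e-c n) ⟩
      y ^ n * (c n + X n)              ≈⟨ distribˡ _ _ _ ⟩
      scale y c n + scale y X n        ≈⟨ +-congˡ (scale-X y n) ⟩
      scale y c n + (const y ⊛ X) n    ∎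

    -- Multiply c(yt) c(zt) c((y+z)t) by exp ((y+z)t). Absorbing the exponential into the last
    -- factor gives c(yt) c(zt) (c((y+z)t) + (y+z)t); splitting it between the first two gives
    -- (c(yt) + yt) (c(zt) + zt) c((y+z)t). The triple product cancels, then one factor t.
    threeTerm : ∀ y z → const (y + z) ⊛ (scale y c ⊛ scale z c) ≋
      const z ⊛ (scale y c ⊛ scale (y + z) c) ⊕ const y ⊛ (scale z c ⊛ scale (y + z) c)
        ⊕ const y ⊛ const z ⊛ (X ⊛ scale (y + z) c)
    threeTerm y z = X⊛-cancel _ _ (P.+-cancelˡ (cy ⊛ cz ⊛ cs) _ _
      (P.trans (P.solve 5 (λ a b c x s → a P.:* b P.:* c P.:+ x P.:* (s P.:* (a P.:* b))
                   P.:= a P.:* b P.:* (c P.:+ s P.:* x)) P.refl cy cz cs X (const (y + z)))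
      (P.trans (⊛-cong (P.refl {cy ⊛ cz}) (P.trans (P.sym (scale-e-c (y + z)))
                  (⊛-cong (P.sym (scale-e-⊛ y z)) (P.refl {cs}))))
      (P.trans (P.solve 5 (λ a b c u v → a P.:* b P.:* ((u P.:* v) P.:* c) P.:= (u P.:* a) P.:*
           (v P.:* b) P.:* c)
                  P.refl cy cz cs (scale y e) (scale z e))
      (P.trans (⊛-cong (⊛-cong (scale-e-c y) (scale-e-c z)) (P.refl {cs}))
      (P.solve 6 (λ a b c x y z → (a P.:+ y P.:* x) P.:* (b P.:+ z P.:* x) P.:* c
          P.:= a P.:* b P.:* c P.:+ x P.:* (z P.:* (a P.:* c) P.:+ y P.:* (b P.:* c) P.:+ y P.:* z P.:*
               (x P.:* c)))
        P.refl cy cz cs X (const y) (const z)))))))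
      where
      cy cz cs : Series
      cy = scale y c
      cz = scale z c
      cs = scale (y + z) c

    -- For y = 1 and z = -1 the sum y + z is zero and c(0 t) = 1, so `threeTerm` becomes 0 = - c(t)
    -- + c(-t) - t.
    reflection : c 0 ≈ 1# → scale (- 1#) c ≋ c ⊕ X
    reflection c-zero n = begin
      c₋ n
        ≈⟨ trans (+-cong (+-congˡ (-‿inverseʳ (c n))) (-‿inverseʳ (X n))) (trans (+-identityʳ _)
             (+-identityʳ _)) ⟨
      c₋ n + (c n + - c n) + (X n + - X n)
        ≈⟨ solve 5 (λ a b b′ x x′ → a :+ (b :+ b′) :+ (x :+ x′) := (b :+ x) :+ (b′ :+ a :+ x′)) refl
             (c₋ n) (c n) (- c n) (X n) (- X n) ⟩
      (c n + X n) + (- c n + c₋ n + - X n)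
        ≈⟨ +-congˡ vanishing ⟩
      (c n + X n) + 0#
        ≈⟨ +-identityʳ _ ⟩
      c n + X n ∎
      where
      c₋ : Series
      c₋ = scale (- 1#) c

      s : Carrier
      s = 1# + - 1#

      scale-s : scale s c ≋ const 1#
      scale-s zero    = trans (*-identityˡ _) c-zero
      scale-s (suc k) = trans (*-congʳ (trans (*-congʳ (-‿inverseʳ 1#)) (zeroˡ _))) (zeroˡ _)

      ⊛-scale-s : ∀ f g → f ≋ g → f ⊛ scale s c ≋ g
      ⊛-scale-s f g p = P.trans (⊛-cong p scale-s) (P.*-identityʳ g)

      vanishing : - c n + c₋ n + - X n ≈ 0#
      vanishing = begin
        - c n + c₋ n + - X n
          ≈⟨ +-cong (+-cong
               (trans (const-⊛ (- 1#) (scale 1# c ⊛ scale s c) n)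
                 (trans (*-congˡ (⊛-scale-s _ _ (scale-1 c) n)) (-1*x≈-x (c n))))
               (trans (1⊛ (c₋ ⊛ scale s c) n) (⊛-scale-s _ _ (P.refl {c₋}) n)))
               (trans (⊛-cong (1⊛ (const (- 1#))) (P.refl {X ⊛ scale s c}) n)
                 (trans (const-⊛ (- 1#) (X ⊛ scale s c) n)
                   (trans (*-congˡ (⊛-scale-s _ _ (P.refl {X}) n)) (-1*x≈-x (X n))))) ⟨
        _ ≈⟨ threeTerm 1# (- 1#) n ⟨
        (const s ⊛ (scale 1# c ⊛ c₋)) n
          ≈⟨ const-⊛ s (scale 1# c ⊛ c₋) n ⟩
        s * (scale 1# c ⊛ c₋) n
          ≈⟨ trans (*-congʳ (-‿inverseʳ 1#)) (zeroˡ _) ⟩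
        0# ∎

open import Defs
open import Data.Nat.Combinatorics using (_C_; nCn≡1; nC1≡n; k>n⇒nCk≡0; nCk+nC[k+1]≡[n+1]C[k+1])
import Data.Nat.Properties as ℕₚ
import Data.Integer as ℤ
open import Data.Integer using (+_)
import Data.Integer.Properties as ℤₚ
open import Data.List using (List; []; _∷_)
open import Data.Rational using (ℚ; _+_; _*_; -_; _-_; 0ℚ; 1ℚ; ½; _/_; toℚᵘ)
open import Data.Rational.Properties using (+-*-commutativeRing; +-comm; +-assoc; +-identityˡ; +-identityʳ; +-inverseˡ)
open import Data.Rational.Properties using (*-assoc; *-identityˡ; *-identityʳ; *-zeroˡ; *-zeroʳ; *-distribˡ-+; *-distribʳ-+)
open import Data.Rational.Properties using (toℚᵘ-injective; toℚᵘ-fromℚᵘ; toℚᵘ-homo-+; toℚᵘ-homo-*)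
open import Data.Rational.Solver using (module +-*-Solver)
open import Data.Rational.Unnormalised as ℚᵘ using (mkℚᵘ; *≡*)
import Data.Rational.Unnormalised.Properties as ℚᵘₚ
open import Data.Sum using (_⊎_; inj₁; inj₂)
open import Relation.Binary.Definitions using (tri<; tri≈; tri>)
open import Relation.Binary.PropositionalEquality using (_≡_; _≢_; refl; cong; cong₂; trans; sym; module ≡-Reasoning)
open import Relation.Nullary using (yes; no; contradiction)

open +-*-Solver using (solve; con; _:+_; _:*_; :-_; _:-_; _:=_)

-- The recursion that defines the Bernoulli coefficients

weightedSum : ℕ → List ℚ → ℚ
weightedSum i []       = 0ℚ
weightedSum i (x ∷ xs) = x ÷! suc (suc i) + weightedSum (suc i) xs

-- Stated for an arbitrary `s`, because the recursion behind `bernList` has no accessible name and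
-- is known only through its two equations.
weightedSum-unique : (s : ℕ → List ℚ → ℚ) → (∀ i → s i [] ≡ 0ℚ) →
  (∀ i x xs → s i (x ∷ xs) ≡ x ÷! suc (suc i) + s (suc i) xs) →
  ∀ i xs → s i xs ≡ weightedSum i xs
weightedSum-unique s p q i []       = p i
weightedSum-unique s p q i (x ∷ xs) =
  trans (q i x xs) (cong (λ z → x ÷! suc (suc i) + z) (weightedSum-unique s p q (suc i) xs))

-- The recursion behind bernList is private to Defs; unification recovers it from the unfolding of bernCoeff (suc m)
-- once its arguments have been abstracted to variables.
mutual
  defsStep : ℕ → List ℚ → ℚ
  defsStep = _

  bernCoeff-suc′ : ∀ m → bernCoeff (suc m) ≡ - defsStep 0 (bernList m)
  bernCoeff-suc′ m with zero | bernList m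
  ... | i | xs = refl

bernCoeff-suc : ∀ m → bernCoeff (suc m) ≡ - weightedSum 0 (bernList m)
bernCoeff-suc m = trans (bernCoeff-suc′ m)
  (cong -_ (weightedSum-unique defsStep (λ _ → refl) (λ _ _ _ → refl) 0 (bernList m)))

-- Rational numbers and Bernoulli coefficients

ℤ→ℚ-+ : ∀ i j → ℤ→ℚ (i ℤ.+ j) ≡ ℤ→ℚ i + ℤ→ℚ j
ℤ→ℚ-+ i j = toℚᵘ-injective (begin
  toℚᵘ (ℤ→ℚ (i ℤ.+ j))               ≈⟨ toℚᵘ-fromℚᵘ (mkℚᵘ (i ℤ.+ j) 0) ⟩
  mkℚᵘ (i ℤ.+ j) 0                   ≈⟨ *≡* (cong (ℤ._* + 1) (cong₂ ℤ._+_ (sym (ℤₚ.*-identityʳ i)) (sym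
       (ℤₚ.*-identityʳ j)))) ⟩
  mkℚᵘ i 0 ℚᵘ.+ mkℚᵘ j 0             ≈⟨ ℚᵘₚ.+-cong (toℚᵘ-fromℚᵘ (mkℚᵘ i 0)) (toℚᵘ-fromℚᵘ (mkℚᵘ j 0)) ⟨
  toℚᵘ (ℤ→ℚ i) ℚᵘ.+ toℚᵘ (ℤ→ℚ j)     ≈⟨ toℚᵘ-homo-+ (ℤ→ℚ i) (ℤ→ℚ j) ⟨
  toℚᵘ (ℤ→ℚ i + ℤ→ℚ j)               ∎)
  where open import Relation.Binary.Reasoning.Setoid ℚᵘₚ.≃-setoid

ℤ→ℚ-* : ∀ i j → ℤ→ℚ (i ℤ.* j) ≡ ℤ→ℚ i * ℤ→ℚ j
ℤ→ℚ-* i j = toℚᵘ-injective (begin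
  toℚᵘ (ℤ→ℚ (i ℤ.* j))               ≈⟨ toℚᵘ-fromℚᵘ (mkℚᵘ (i ℤ.* j) 0) ⟩
  mkℚᵘ i 0 ℚᵘ.* mkℚᵘ j 0             ≈⟨ ℚᵘₚ.*-cong (toℚᵘ-fromℚᵘ (mkℚᵘ i 0)) (toℚᵘ-fromℚᵘ (mkℚᵘ j 0)) ⟨
  toℚᵘ (ℤ→ℚ i) ℚᵘ.* toℚᵘ (ℤ→ℚ j)     ≈⟨ toℚᵘ-homo-* (ℤ→ℚ i) (ℤ→ℚ j) ⟨
  toℚᵘ (ℤ→ℚ i * ℤ→ℚ j)               ∎)
  where open import Relation.Binary.Reasoning.Setoid ℚᵘₚ.≃-setoid

ℤ→ℚ-neg : ∀ n → ℤ→ℚ (ℤ.- + n) ≡ - ℕ→ℚ n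
ℤ→ℚ-neg zero    = refl
ℤ→ℚ-neg (suc n) = refl

ℕ→ℚ-+ : ∀ m n → ℕ→ℚ (m ℕ.+ n) ≡ ℕ→ℚ m + ℕ→ℚ n
ℕ→ℚ-+ m n = ℤ→ℚ-+ (+ m) (+ n)

ℕ→ℚ-suc : ∀ n → ℕ→ℚ (suc n) ≡ 1ℚ + ℕ→ℚ n
ℕ→ℚ-suc n = ℕ→ℚ-+ 1 n

ℕ→ℚ-* : ∀ m n → ℕ→ℚ (m ℕ.* n) ≡ ℕ→ℚ m * ℕ→ℚ n
ℕ→ℚ-* m n = trans (cong ℤ→ℚ (ℤₚ.pos-* m n)) (ℤ→ℚ-* (+ m) (+ n))

ℕ→ℚ-inverse : ∀ m .{{_ : ℕ.NonZero m}} → ℕ→ℚ m * (+ 1 / m) ≡ 1ℚ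
ℕ→ℚ-inverse m@(suc m-1) = toℚᵘ-injective (begin
  toℚᵘ (ℕ→ℚ m * (+ 1 / m))              ≈⟨ toℚᵘ-homo-* (ℕ→ℚ m) (+ 1 / m) ⟩
  toℚᵘ (ℕ→ℚ m) ℚᵘ.* toℚᵘ (+ 1 / m)      ≈⟨ ℚᵘₚ.*-cong (toℚᵘ-fromℚᵘ (mkℚᵘ (+ m) 0)) (toℚᵘ-fromℚᵘ (mkℚᵘ
       (+ 1) m-1)) ⟩
  mkℚᵘ (+ m) 0 ℚᵘ.* mkℚᵘ (+ 1) m-1      ≈⟨ *≡* (trans (ℤₚ.*-identityʳ _) (trans (ℤₚ.*-identityʳ (+ m))
       (sym (trans (ℤₚ.*-identityˡ _) (cong +_ (ℕₚ.+-identityʳ m)))))) ⟩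
  toℚᵘ 1ℚ                               ∎)
  where open import Relation.Binary.Reasoning.Setoid ℚᵘₚ.≃-setoid

!-inv! : ∀ n → ℕ→ℚ (n !) * inv! n ≡ 1ℚ
!-inv! n = ℕ→ℚ-inverse (n !) {{n ℕₚ.!≢0}}

suc-inv! : ∀ n → ℕ→ℚ (suc n) * inv! (suc n) ≡ inv! n
suc-inv! n = begin
  ℕ→ℚ (suc n) * inv! (suc n)                               ≡⟨ *-identityˡ _ ⟨
  1ℚ * (ℕ→ℚ (suc n) * inv! (suc n))                        ≡⟨ cong (_* (ℕ→ℚ (suc n) * inv! (suc n)))
       (!-inv! n) ⟨
  ℕ→ℚ (n !) * inv! n * (ℕ→ℚ (suc n) * inv! (suc n))
    ≡⟨ solve 4 (λ a b c d → a :* b :* (c :* d) := b :* (c :* a :* d))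
         refl (ℕ→ℚ (n !)) (inv! n) (ℕ→ℚ (suc n)) (inv! (suc n)) ⟩
  inv! n * (ℕ→ℚ (suc n) * ℕ→ℚ (n !) * inv! (suc n))        ≡⟨ cong (λ x → inv! n * (x * inv! (suc n)))
       (ℕ→ℚ-* (suc n) (n !)) ⟨
  inv! n * (ℕ→ℚ (suc n !) * inv! (suc n))                  ≡⟨ cong (inv! n *_) (!-inv! (suc n)) ⟩
  inv! n * 1ℚ                                              ≡⟨ *-identityʳ _ ⟩
  inv! n                                                   ∎
  where open ≡-Reasoning

B÷! : ∀ m → B m ÷! m ≡ bernCoeff m
B÷! m = begin
  ℕ→ℚ (m !) * bernCoeff m * inv! m
    ≡⟨ solve 3 (λ a b c → a :* b :* c := a :* c :* b) refl (ℕ→ℚ (m !)) (bernCoeff m) (inv! m) ⟩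
  ℕ→ℚ (m !) * inv! m * bernCoeff m ≡⟨ cong (_* bernCoeff m) (!-inv! m) ⟩
  1ℚ * bernCoeff m                 ≡⟨ *-identityˡ _ ⟩
  bernCoeff m                      ∎
  where open ≡-Reasoning

module ℚ[[w]] = PowerSeries +-*-commutativeRing

ℚ[[w]]-ring : CommutativeRing 0ℓ 0ℓ
ℚ[[w]]-ring = ℚ[[w]].commutativeRing-⊛

module ExpBernoulli where
  open ℚ[[w]]

  -- Since `bernList m` runs from c m down to c 0, the weighted sum is a coefficient of a Cauchy
  -- product. The offset `i` is general for the sake of the induction; `i = 0` is the case that
  -- occurs in the recursion.
  weightedSum-bernList : ∀ i m →
    weightedSum i (bernList m) ≡ (bernCoeff ⊛ (λ n → inv! (suc (suc (i ℕ.+ n))))) m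
  weightedSum-bernList i zero    = trans (+-identityʳ _) (cong (λ j → 1ℚ * inv! (suc (suc j))) (sym
       (ℕₚ.+-identityʳ i)))
  weightedSum-bernList i (suc m) = begin
    bernCoeff (suc m) * inv! (suc (suc i)) + weightedSum (suc i) (bernList m)
      ≡⟨ cong₂ _+_ (cong (λ j → bernCoeff (suc m) * inv! (suc (suc j))) (sym (ℕₚ.+-identityʳ i)))
           (trans (weightedSum-bernList (suc i) m)
             (⊛-cong {f = bernCoeff} (λ _ → refl) (λ n → cong (λ j → inv! (suc (suc j))) (sym
                  (ℕₚ.+-suc i n))) m)) ⟩
    bernCoeff (suc m) * inv! (suc (suc (i ℕ.+ 0))) + (bernCoeff ⊛ (λ n → inv! (suc (suc (i ℕ.+ suc n))))) m
      ≡⟨ ⊛-suc bernCoeff (λ n → inv! (suc (suc (i ℕ.+ n)))) m ⟨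
    (bernCoeff ⊛ (λ n → inv! (suc (suc (i ℕ.+ n))))) (suc m) ∎
    where open ≡-Reasoning

  -- Here `tail inv!` is (eᵗ - 1)/t, so this is the generating function of the Bernoulli numbers
  -- with its denominator cleared.
  bernCoeff-⊛-expm1 : bernCoeff ⊛ tail inv! ≋ const 1ℚ
  bernCoeff-⊛-expm1 zero    = refl
  bernCoeff-⊛-expm1 (suc m) = begin
    (bernCoeff ⊛ tail inv!) (suc m)                            ≡⟨ ⊛-suc bernCoeff (tail inv!) m ⟩
    bernCoeff (suc m) * 1ℚ + (bernCoeff ⊛ tail (tail inv!)) m
      ≡⟨ cong₂ _+_ (trans (*-identityʳ _) (bernCoeff-suc m)) (sym (weightedSum-bernList 0 m)) ⟩
    - weightedSum 0 (bernList m) + weightedSum 0 (bernList m)  ≡⟨ +-inverseˡ (weightedSum 0 (bernList m)) ⟩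
    0ℚ                                                         ∎
    where open ≡-Reasoning

  exp-⊛-bernCoeff : inv! ⊛ bernCoeff ≋ bernCoeff ⊕ X
  exp-⊛-bernCoeff n = trans (⊛-comm inv! bernCoeff n) (lemma n)
    where
    lemma : bernCoeff ⊛ inv! ≋ bernCoeff ⊕ X
    lemma zero    = refl
    lemma (suc n) = trans (⊛-suc bernCoeff inv! n)
      (cong₂ _+_ (*-identityʳ (bernCoeff (suc n))) (trans (bernCoeff-⊛-expm1 n) (1≋tailX n)))
      where
      1≋tailX : const 1ℚ ≋ tail X
      1≋tailX zero    = refl
      1≋tailX (suc _) = refl

  fromℕ≡ℕ→ℚ : ∀ n → fromℕ n ≡ ℕ→ℚ n
  fromℕ≡ℕ→ℚ zero    = refl
  fromℕ≡ℕ→ℚ (suc n) = trans (cong (λ x → 1ℚ + x) (fromℕ≡ℕ→ℚ n)) (sym (ℕ→ℚ-suc n))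

  -- This is 1/(n+1), written as n!/(n+1)!.
  recip : ℕ → ℚ
  recip n = ℕ→ℚ (n !) * inv! (suc n)

  recip-inverse : ∀ n → recip n * fromℕ (suc n) ≡ 1ℚ
  recip-inverse n = begin
    ℕ→ℚ (n !) * inv! (suc n) * fromℕ (suc n)   ≡⟨ cong (recip n *_) (fromℕ≡ℕ→ℚ (suc n)) ⟩
    ℕ→ℚ (n !) * inv! (suc n) * ℕ→ℚ (suc n)
      ≡⟨ solve 3 (λ a b c → a :* b :* c := a :* (c :* b)) refl (ℕ→ℚ (n !)) (inv! (suc n)) (ℕ→ℚ (suc n)) ⟩
    ℕ→ℚ (n !) * (ℕ→ℚ (suc n) * inv! (suc n))   ≡⟨ cong (ℕ→ℚ (n !) *_) (suc-inv! n) ⟩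
    ℕ→ℚ (n !) * inv! n                         ≡⟨ !-inv! n ⟩
    1ℚ                                         ∎
    where open ≡-Reasoning

  fromℕ-inv! : ∀ n → fromℕ (suc n) * inv! (suc n) ≡ inv! n
  fromℕ-inv! n = trans (cong (_* inv! (suc n)) (fromℕ≡ℕ→ℚ (suc n))) (suc-inv! n)

open ExpBernoulli

-- Signs, and Bernoulli coefficients of odd index

signPow-+ : ∀ m n → signPow (m ℕ.+ n) ≡ signPow m * signPow n
signPow-+ zero    n = sym (*-identityˡ (signPow n))
signPow-+ (suc m) n = trans (cong -_ (signPow-+ m n))
  (solve 2 (λ a b → :- (a :* b) := (:- a) :* b) refl (signPow m) (signPow n))

signPow-±1 : ∀ n → signPow n ≡ 1ℚ ⊎ signPow n ≡ - 1ℚ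
signPow-±1 zero    = inj₁ refl
signPow-±1 (suc n) with signPow-±1 n
... | inj₁ p = inj₂ (cong -_ p)
... | inj₂ p = inj₁ (cong -_ p)

half : ∀ x → - x ≡ x → x ≡ 0ℚ
half x p = begin
  x                        ≡⟨ solve 1 (λ x → x := con ½ :* (x :- (:- x))) refl x ⟩
  ½ * (x - (- x))          ≡⟨ cong (λ y → ½ * (x - y)) p ⟩
  ½ * (x - x)              ≡⟨ solve 1 (λ x → con ½ :* (x :- x) := con 0ℚ) refl x ⟩
  0ℚ                       ∎
  where open ≡-Reasoning

private
  module ℚExp = Exp (CommutativeRing.semiring +-*-commutativeRing)

signPow-^ : ∀ n → (- 1ℚ) ℚExp.^ n ≡ signPow n
signPow-^ zero    = refl
signPow-^ (suc n) = trans (cong (- 1ℚ *_) (signPow-^ n))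
  (solve 1 (λ a → (:- con 1ℚ) :* a := :- a) refl (signPow n))

-- The coefficient of degree k + 2 in `reflection` reads - c = c for odd k. Writing the index as k +
-- 2 keeps away from degree 1, where `X` contributes.
bernCoeff-odd : ∀ k → signPow k ≡ - 1ℚ → bernCoeff (suc (suc k)) ≡ 0ℚ
bernCoeff-odd k p = half _ (begin
  - c                      ≡⟨ solve 1 (λ a → :- a := (:- (:- (:- con 1ℚ))) :* a) refl c ⟩
  - - - 1ℚ * c             ≡⟨ cong (λ x → - - x * c) p ⟨
  - - signPow k * c        ≡⟨ cong (_* c) (signPow-^ (suc (suc k))) ⟨
  (- 1ℚ) ℚExp.^ suc (suc k) * c
    ≡⟨ BernoulliSeries.reflection +-*-commutativeRing recip recip-inverse inv! bernCoeff
         refl fromℕ-inv! exp-⊛-bernCoeff refl (suc (suc k)) ⟩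
  c + 0ℚ                   ≡⟨ +-identityʳ c ⟩
  c                        ∎)
  where
  open ≡-Reasoning
  c : ℚ
  c = bernCoeff (suc (suc k))

-- Bernoulli series with coefficients in ℚ[[w]]

module ℚ[[w]][[t]] = PowerSeries ℚ[[w]]-ring

module BivariateBernoulli where
  open ℚ[[w]] using (const; const-*; const-+)
  open ℚ[[w]][[t]] using (Series; _≋_; _⊕_; _⊛_; X; scale; fromℕ)
  open CommutativeRing ℚ[[w]]-ring using () renaming (trans to ≈-trans; sym to ≈-sym;
       refl to ≈-refl; +-cong to ≈-+-cong; *-cong to ≈-*-cong)

  constants : (ℕ → ℚ) → Series
  constants f n = const (f n)

  constants-⊛ : ∀ f g → constants f ⊛ constants g ≋ constants (f ℚ[[w]].⊛ g)
  constants-⊛ f g zero    = ≈-sym (const-* (f 0) (g 0))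
  constants-⊛ f g (suc n) = ≈-trans
    (≈-+-cong (≈-sym (const-* (f 0) (g (suc n)))) (constants-⊛ (λ k → f (suc k)) g n))
    (≈-sym (const-+ (f 0 * g (suc n)) (((λ k → f (suc k)) ℚ[[w]].⊛ g) n)))

  fromℕ-const : ∀ n → fromℕ n ℚ[[w]].≋ const (ℚ[[w]].fromℕ n)
  fromℕ-const zero    zero    = refl
  fromℕ-const zero    (suc k) = refl
  fromℕ-const (suc n) k = trans (cong (λ x → const 1ℚ k + x) (fromℕ-const n k)) (sym (const-+ 1ℚ
       (ℚ[[w]].fromℕ n) k))

  const-cong : ∀ {a b} → a ≡ b → const a ℚ[[w]].≋ const b
  const-cong refl _ = refl

  c e : Series
  c = constants bernCoeff
  e = constants inv!

  private
    K : ℚ[[w]].Series → Series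
    K = ℚ[[w]][[t]].const

  threeTerm : ∀ y z → K (y ℚ[[w]].⊕ z) ⊛ (scale y c ⊛ scale z c) ≋
    K z ⊛ (scale y c ⊛ scale (y ℚ[[w]].⊕ z) c) ⊕ K y ⊛ (scale z c ⊛ scale (y ℚ[[w]].⊕ z) c)
      ⊕ K y ⊛ K z ⊛ (X ⊛ scale (y ℚ[[w]].⊕ z) c)
  threeTerm = BernoulliSeries.threeTerm ℚ[[w]]-ring (constants recip)
    (λ n → ≈-trans (≈-*-cong (≈-refl {const (recip n)}) (fromℕ-const (suc n)))
      (≈-trans (≈-sym (const-* (recip n) (ℚ[[w]].fromℕ (suc n)))) (const-cong (recip-inverse n))))
    e c ≈-refl
    (λ n → ≈-trans (≈-*-cong (fromℕ-const (suc n)) (≈-refl {e (suc n)}))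
      (≈-trans (≈-sym (const-* (ℚ[[w]].fromℕ (suc n)) (inv! (suc n)))) (const-cong (fromℕ-inv! n))))
    (λ n → ≈-trans (constants-⊛ inv! bernCoeff n) (≈-trans (const-cong (exp-⊛-bernCoeff n))
      (≈-trans (const-+ (bernCoeff n) (ℚ[[w]].X n)) (≈-+-cong (≈-refl {c n}) (const-X n)))))
    where
    const-X : ∀ n → const (ℚ[[w]].X n) ℚ[[w]].≋ X n
    const-X zero          zero    = refl
    const-X zero          (suc k) = refl
    const-X (suc zero)    k       = refl
    const-X (suc (suc n)) zero    = refl
    const-X (suc (suc n)) (suc k) = refl

-- The case r₁ = 0

sumBelow-cong : ∀ n {f g : ℕ → ℚ} → (∀ i → i < n → f i ≡ g i) → sumBelow n f ≡ sumBelow n g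
sumBelow-cong zero    p = refl
sumBelow-cong (suc n) p =
  cong₂ _+_ (sumBelow-cong n (λ i i<n → p i (ℕₚ.m<n⇒m<1+n i<n))) (p n (ℕₚ.n<1+n n))

-- shift k f lists the coefficients of wᵏ Σ f(j) wʲ.
shift : ℕ → (ℕ → ℚ) → ℕ → ℚ
shift zero    f m       = f m
shift (suc k) f zero    = 0ℚ
shift (suc k) f (suc m) = shift k f m

shift-cong : ∀ k {f g : ℕ → ℚ} → (∀ m → f m ≡ g m) → ∀ m → shift k f m ≡ shift k g m
shift-cong zero    p m       = p m
shift-cong (suc k) p zero    = refl
shift-cong (suc k) p (suc m) = shift-cong k p m

shift-* : ∀ k a f m → shift k (λ j → a * f j) m ≡ a * shift k f m
shift-* zero    a f m       = refl
shift-* (suc k) a f zero    = sym (*-zeroʳ a)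
shift-* (suc k) a f (suc m) = shift-* k a f m

shift-< : ∀ k f m → m < k → shift k f m ≡ 0ℚ
shift-< (suc k) f zero    _         = refl
shift-< (suc k) f (suc m) (s≤s m<k) = shift-< k f m m<k

-- The coefficients of (1 + w)^(n - 1), including the inverse of 1 + w at n = 0.
binomialRow : ℕ → ℕ → ℚ
binomialRow zero    b = signPow b
binomialRow (suc n) b = ℕ→ℚ (n C b)

module Base where
  open BivariateBernoulli
  open ℚ[[w]] using (_·_)
  open ℚ[[w]][[t]] using (Series; _≋_; _⊕_; _⊛_; X; scale; const-⊛; X⊛-suc; ⊛-cong; ⊛-ends; ⊛-suc; tail)
  private
    module W where
      open CommutativeRing ℚ[[w]]-ring public
      open Exp (CommutativeRing.semiring ℚ[[w]]-ring) public using (_^_)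
      open ℚ[[w]] public using (X; const; X⊛-zero; X⊛-suc; 1⊛; const-⊛; ·-⊛-assoc; ⊛-cong)
    module T where
      open CommutativeRing ℚ[[w]][[t]].commutativeRing-⊛ public
      open NatSolver (CommutativeRing.commutativeSemiring ℚ[[w]][[t]].commutativeRing-⊛) public
        using (solve; _:+_; _:*_; _:=_)

    K : W.Carrier → Series
    K = ℚ[[w]][[t]].const

  w y : W.Carrier
  w = W.X
  y = W.1# W.+ w

  w^-coeff : ∀ k f m → (w W.^ k W.* f) m ≡ shift k f m
  w^-coeff zero    f m       = W.1⊛ f m
  w^-coeff (suc k) f zero    = trans (W.*-assoc w (w W.^ k) f 0) (W.X⊛-zero (w W.^ k W.* f))
  w^-coeff (suc k) f (suc m) = trans (W.*-assoc w (w W.^ k) f (suc m))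
    (trans (W.X⊛-suc (w W.^ k W.* f) m) (w^-coeff k f m))

  -- Pascal's rule for positive n; for n = 0 it says that Σ (-w)ʲ inverts 1 + w.
  y-binomialRow : ∀ n → y W.* binomialRow n W.≈ binomialRow (suc n)
  y-binomialRow n m = trans (W.distribʳ (binomialRow n) W.1# w m)
    (trans (cong (_+ (w W.* binomialRow n) m) (W.1⊛ (binomialRow n) m)) (pascal n m))
    where
    pascal : ∀ n m → binomialRow n m + (w W.* binomialRow n) m ≡ binomialRow (suc n) m
    pascal zero    zero    = refl
    pascal (suc n) zero    = trans (cong (λ x → 1ℚ + x) (W.X⊛-zero (binomialRow (suc n)))) (+-identityʳ 1ℚ)
    pascal zero    (suc m) = trans (cong (λ x → - signPow m + x) (W.X⊛-suc signPow m))
      (+-inverseˡ (signPow m))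
    pascal (suc n) (suc m) = begin
      ℕ→ℚ (n C suc m) + (w W.* binomialRow (suc n)) (suc m)
        ≡⟨ cong (λ x → ℕ→ℚ (n C suc m) + x) (W.X⊛-suc (binomialRow (suc n)) m) ⟩
      ℕ→ℚ (n C suc m) + ℕ→ℚ (n C m)   ≡⟨ ℕ→ℚ-+ (n C suc m) (n C m) ⟨
      ℕ→ℚ (n C suc m ℕ.+ n C m)       ≡⟨ cong ℕ→ℚ (ℕₚ.+-comm (n C suc m) (n C m)) ⟩
      ℕ→ℚ (n C m ℕ.+ n C suc m)       ≡⟨ cong ℕ→ℚ (nCk+nC[k+1]≡[n+1]C[k+1] n m) ⟩
      ℕ→ℚ (suc n C suc m)             ∎
      where open ≡-Reasoning

  binomialRow-1 : binomialRow 1 W.≈ W.1#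
  binomialRow-1 zero    = refl
  binomialRow-1 (suc m) = refl

  -- A factor 1 + w is split off from every power, the zeroth included, so that it can be cancelled
  -- later.
  y^ : ∀ n → y W.^ n W.≈ y W.* binomialRow n
  y^ zero    = W.sym (W.trans (y-binomialRow 0) binomialRow-1)
  y^ (suc n) = W.*-cong (W.refl {y}) (W.trans (y^ n) (y-binomialRow n))

  -- The series c((1+w)t)/(1+w).
  Φ : Series
  Φ n = bernCoeff n · binomialRow n

  scale-y-c : scale y c ≋ K y ⊛ Φ
  scale-y-c n = W.trans (W.*-cong (y^ n) (W.refl {c n}))
    (W.trans (W.*-comm (y W.* binomialRow n) (c n))
    (W.trans (W.const-⊛ (bernCoeff n) (y W.* binomialRow n))
    (W.trans (W.sym (W.·-⊛-assoc (bernCoeff n) y (binomialRow n)))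
    (W.trans (W.*-cong (W.sym (W.const-⊛ (bernCoeff n) y)) (W.refl {binomialRow n}))
    (W.trans (W.*-cong (W.*-comm (c n) y) (W.refl {binomialRow n}))
    (W.trans (W.*-assoc y (c n) (binomialRow n))
    (W.trans (W.*-cong (W.refl {y}) (W.const-⊛ (bernCoeff n) (binomialRow n)))
      (W.sym (const-⊛ y Φ n)))))))))

  -- Every right-hand term of `threeTerm` at y = 1, z = w contains c((1+w)t) = (1+w) Φ, and the
  -- left-hand side has the factor 1 + w. Multiplication by the inverse `v` of 1 + w removes it
  -- throughout.
  baseSeries : scale w c ⊛ c ≋ K w ⊛ (c ⊛ Φ) ⊕ scale w c ⊛ Φ ⊕ K w ⊛ (X ⊛ Φ)
  baseSeries = T.trans (T.sym (T.*-identityˡ (cw ⊛ c))) (T.trans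
    (T.*-cong (T.sym v⊛Y) (T.refl {cw ⊛ c})) (T.trans
    (T.solve 4 (λ v Y a b → v T.:* Y T.:* (a T.:* b) T.:= v T.:* (Y T.:* (b T.:* a))) T.refl v
         (K y) cw c) (T.trans
    (T.*-cong (T.refl {v}) expanded) (T.trans
    (T.solve 7 (λ v Y W x a b f → v T.:* (W T.:* (b T.:* (Y T.:* f)) T.:+ a T.:* (Y T.:* f) T.:+ W T.:*
         (x T.:* (Y T.:* f)))
        T.:= v T.:* Y T.:* (W T.:* (b T.:* f) T.:+ a T.:* f T.:+ W T.:* (x T.:* f)))
      T.refl v (K y) (K w) X cw c Φ)
    (T.trans (T.*-cong v⊛Y (T.refl {K w ⊛ (c ⊛ Φ) ⊕ cw ⊛ Φ ⊕ K w ⊛ (X ⊛ Φ)}))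
      (T.*-identityˡ _))))))
    where
    cw v : Series
    cw = scale w c
    v = K (binomialRow 0)

    v⊛Y : v ⊛ K y ≋ T.1#
    v⊛Y = T.trans (T.sym (ℚ[[w]][[t]].const-* (binomialRow 0) y)) λ
      { zero → W.trans (W.*-comm (binomialRow 0) y) (W.trans (y-binomialRow 0) binomialRow-1)
      ; (suc n) → W.refl }

    c₁ : scale W.1# c ≋ c
    c₁ = ℚ[[w]][[t]].scale-1 c

    expanded : K y ⊛ (c ⊛ cw) ≋ K w ⊛ (c ⊛ (K y ⊛ Φ)) ⊕ cw ⊛ (K y ⊛ Φ) ⊕ K w ⊛ (X ⊛ (K y ⊛ Φ))
    expanded = T.trans (T.*-cong (T.refl {K y}) (T.*-cong (T.sym c₁) (T.refl {cw})))
      (T.trans (threeTerm W.1# w)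
        (T.+-cong (T.+-cong
          (T.*-cong (T.refl {K w}) (T.*-cong c₁ scale-y-c))
          (T.trans (T.*-identityˡ (cw ⊛ scale y c)) (T.*-cong (T.refl {cw}) scale-y-c)))
          (T.*-cong (T.*-identityˡ (K w)) (T.*-cong (T.refl {X}) scale-y-c))))

  ⊛-sumBelow : ∀ F G M b → (F ⊛ G) M b ≡ sumBelow (suc M) (λ i → (F i W.* G (M ∸ i)) b)
  ⊛-sumBelow F G zero    b = sym (+-identityˡ _)
  ⊛-sumBelow F G (suc M) b = begin
    (F ⊛ G) (suc M) b                          ≡⟨ ⊛-suc F G M b ⟩
    (F (suc M) W.* G 0) b + (F ⊛ tail G) M b   ≡⟨ +-comm ((F (suc M) W.* G 0) b) _ ⟩
    (F ⊛ tail G) M b + (F (suc M) W.* G 0) b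
      ≡⟨ cong₂ _+_
           (trans (⊛-sumBelow F (tail G) M b) (sumBelow-cong (suc M) (λ i i≤M →
             cong (λ j → (F i W.* G j) b) (sym (ℕₚ.+-∸-assoc 1 (ℕₚ.≤-pred i≤M))))))
           (cong (λ j → (F (suc M) W.* G j) b) (sym (ℕₚ.n∸n≡0 M))) ⟩
    sumBelow (suc (suc M)) (λ i → (F i W.* G (suc M ∸ i)) b) ∎
    where open ≡-Reasoning

  scale-w-coeff : ∀ k a f m → (scale w c k W.* (a · f)) m ≡ bernCoeff k * a * shift k f m
  scale-w-coeff k a f m = begin
    (w W.^ k W.* c k W.* (a · f)) m            ≡⟨ W.*-assoc (w W.^ k) (c k) (a · f) m ⟩
    (w W.^ k W.* (c k W.* (a · f))) m          ≡⟨ w^-coeff k (c k W.* (a · f)) m ⟩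
    shift k (c k W.* (a · f)) m                ≡⟨ shift-cong k (λ j → trans (W.const-⊛ (bernCoeff k)
         (a · f) j) (sym (*-assoc (bernCoeff k) a (f j)))) m ⟩
    shift k (λ j → bernCoeff k * a * f j) m    ≡⟨ shift-* k (bernCoeff k * a) f m ⟩
    bernCoeff k * a * shift k f m              ∎
    where open ≡-Reasoning

  c-coeff : ∀ n m → c n m ≡ bernCoeff n * W.1# m
  c-coeff n zero    = sym (*-identityʳ (bernCoeff n))
  c-coeff n (suc m) = sym (*-zeroʳ (bernCoeff n))

  scale-w-⊛-coeff : ∀ (a : ℕ → ℚ) (g : ℕ → W.Carrier) M b → b ≤ M →
    (scale w c ⊛ (λ n → a n · g n)) (suc (suc M)) (suc b) ≡
    a (suc (suc M)) * g (suc (suc M)) (suc b)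
      + sumBelow (suc M) (λ i → bernCoeff (suc i) * a (suc (M ∸ i)) * shift i (g (suc (M ∸ i))) b)
  scale-w-⊛-coeff a g M b b≤M = begin
    (scale w c ⊛ G) N (suc b)
      ≡⟨ ⊛-ends (scale w c) G M (suc b) ⟩
    (scale w c 0 W.* G N) (suc b) + (scale w c N W.* G 0) (suc b)
      + (tail (scale w c) ⊛ tail G) M (suc b)
      ≡⟨ cong₂ _+_ (cong₂ _+_
           (trans (scale-w-coeff 0 (a N) (g N) (suc b)) (cong (_* g N (suc b)) (*-identityˡ (a N))))
           -- This end of the convolution is divisible by w^(M+2), while the exponent b + 1 is
           -- smaller because b ≤ M.
           (trans (scale-w-coeff N (a 0) (g 0) (suc b))
             (trans (cong (bernCoeff N * a 0 *_) (shift-< N (g 0) (suc b) (s≤s (s≤s b≤M)))) (*-zeroʳ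
                  (bernCoeff N * a 0)))))
           (trans (⊛-sumBelow (tail (scale w c)) (tail G) M (suc b)) (sumBelow-cong (suc M) (λ i _ →
             scale-w-coeff (suc i) (a (suc (M ∸ i))) (g (suc (M ∸ i))) (suc b)))) ⟩
    a N * g N (suc b) + 0ℚ + S
      ≡⟨ cong (_+ S) (+-identityʳ (a N * g N (suc b))) ⟩
    a N * g N (suc b) + S ∎
    where
    open ≡-Reasoning
    N : ℕ
    N = suc (suc M)
    G : Series
    G n = a n · g n
    S : ℚ
    S = sumBelow (suc M) (λ i → bernCoeff (suc i) * a (suc (M ∸ i)) * shift i (g (suc (M ∸ i))) b)

  -- The ends are Φ (M+2), as c 0 = 1, and c (M+2) Φ 0 with Φ 0 = 1/(1+w). The second is the origin
  -- of the sign (-1)^r₂ beside B (2n) in the theorem.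
  c-⊛-Φ-coeff : ∀ M b → (c ⊛ Φ) (suc (suc M)) b ≡
    bernCoeff (suc (suc M)) * ℕ→ℚ (suc M C b) + bernCoeff (suc (suc M)) * signPow b
      + sumBelow (suc M) (λ i → bernCoeff (suc i) * bernCoeff (suc (M ∸ i)) * ℕ→ℚ ((M ∸ i) C b))
  c-⊛-Φ-coeff M b = trans (⊛-ends c Φ M b) (cong₂ _+_ (cong₂ _+_
    (W.1⊛ (Φ N) b)
    (trans (W.const-⊛ (bernCoeff N) (Φ 0) b) (cong (bernCoeff N *_) (*-identityˡ (signPow b)))))
    (trans (⊛-sumBelow (tail c) (tail Φ) M b) (sumBelow-cong (suc M) (λ i _ →
      trans (W.const-⊛ (bernCoeff (suc i)) (Φ (suc (M ∸ i))) b) (sym (*-assoc (bernCoeff (suc i)) _ _))))))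
    where
    N : ℕ
    N = suc (suc M)

  K-w-coeff : ∀ F n b → (K w ⊛ F) n (suc b) ≡ F n b
  K-w-coeff F n b = trans (const-⊛ w F n (suc b)) (W.X⊛-suc (F n) b)

  -- The coefficient of t^(M+2) w^(b+1) in `baseSeries`. In the left-hand sum `shift i W.1# b` is
  -- the Kronecker delta of i and b; the single surviving product stays written as a sum so that it
  -- can be combined termwise with other sums over i.
  baseIdentity : ∀ M b → b ≤ M →
    sumBelow (suc M) (λ i → bernCoeff (suc i) * bernCoeff (suc (M ∸ i)) * shift i W.1# b) ≡
    (bernCoeff (suc (suc M)) * ℕ→ℚ (suc M C b) + bernCoeff (suc (suc M)) * signPow b
      + sumBelow (suc M) (λ i → bernCoeff (suc i) * bernCoeff (suc (M ∸ i)) * ℕ→ℚ ((M ∸ i) C b)))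
    + (bernCoeff (suc (suc M)) * ℕ→ℚ (suc M C suc b)
      + sumBelow (suc M) (λ i → bernCoeff (suc i) * bernCoeff (suc (M ∸ i)) * shift i (λ m → ℕ→ℚ
           ((M ∸ i) C m)) b))
    + bernCoeff (suc M) * ℕ→ℚ (M C b)
  baseIdentity M b b≤M = begin
    S
      ≡⟨ trans (cong (_+ S) (*-zeroʳ (bernCoeff N))) (+-identityˡ S) ⟨
    bernCoeff N * 0ℚ + S
      ≡⟨ scale-w-⊛-coeff bernCoeff (λ _ → W.1#) M b b≤M ⟨
    (scale w c ⊛ (λ n → bernCoeff n · W.1#)) N (suc b)
      ≡⟨ ⊛-cong (T.refl {scale w c}) c-coeff N (suc b) ⟨
    (scale w c ⊛ c) N (suc b)
      ≡⟨ baseSeries N (suc b) ⟩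
    (K w ⊛ (c ⊛ Φ)) N (suc b) + (scale w c ⊛ Φ) N (suc b) + (K w ⊛ (X ⊛ Φ)) N (suc b)
      ≡⟨ cong₂ _+_ (cong₂ _+_ (trans (K-w-coeff (c ⊛ Φ) N b) (c-⊛-Φ-coeff M b))
                              (scale-w-⊛-coeff bernCoeff binomialRow M b b≤M))
           (trans (K-w-coeff (X ⊛ Φ) N b) (X⊛-suc Φ (suc M) b)) ⟩
    _ ∎
    where
    open ≡-Reasoning
    N : ℕ
    N = suc (suc M)
    S : ℚ
    S = sumBelow (suc M) (λ i → bernCoeff (suc i) * bernCoeff (suc (M ∸ i)) * shift i W.1# b)

-- Finite sums and absorption identities for binomial coefficients

sumBelow-+ : ∀ n f g → sumBelow n (λ i → f i + g i) ≡ sumBelow n f + sumBelow n g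
sumBelow-+ zero    f g = refl
sumBelow-+ (suc n) f g = trans (cong (_+ (f n + g n)) (sumBelow-+ n f g))
  (solve 4 (λ a b x y → a :+ b :+ (x :+ y) := a :+ x :+ (b :+ y)) refl
    (sumBelow n f) (sumBelow n g) (f n) (g n))

sumBelow-* : ∀ n a f → sumBelow n (λ i → a * f i) ≡ a * sumBelow n f
sumBelow-* zero    a f = sym (*-zeroʳ a)
sumBelow-* (suc n) a f = trans (cong (_+ a * f n) (sumBelow-* n a f))
  (sym (*-distribˡ-+ a (sumBelow n f) (f n)))

sumBelow-zero : ∀ n {f : ℕ → ℚ} → (∀ i → i < n → f i ≡ 0ℚ) → sumBelow n f ≡ 0ℚ
sumBelow-zero zero    p = refl
sumBelow-zero (suc n) p =
  cong₂ _+_ (sumBelow-zero n (λ i i<n → p i (ℕₚ.m<n⇒m<1+n i<n))) (p n (ℕₚ.n<1+n n))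

bin : ℕ → ℕ → ℚ
bin n k = ℕ→ℚ (n C k)

bin-pascal : ∀ n k → bin (suc n) (suc k) ≡ bin n k + bin n (suc k)
bin-pascal n k = trans (cong ℕ→ℚ (sym (nCk+nC[k+1]≡[n+1]C[k+1] n k))) (ℕ→ℚ-+ (n C k) (n C suc k))

bin-< : ∀ n k → n < k → bin n k ≡ 0ℚ
bin-< n k n<k = cong ℕ→ℚ (k>n⇒nCk≡0 n<k)

-- The subtraction is taken in ℚ, so the identity also covers k > n, where both sides vanish. The
-- induction uses Pascal's rule on both sides.
bin-absorb : ∀ n k → (ℕ→ℚ n - ℕ→ℚ k) * bin n k ≡ ℕ→ℚ (suc k) * bin n (suc k)
bin-absorb zero    zero    = refl
bin-absorb zero    (suc k) = trans (*-zeroʳ (0ℚ - ℕ→ℚ (suc k))) (sym (*-zeroʳ (ℕ→ℚ (suc (suc k)))))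
bin-absorb (suc n) zero    = begin
  (ℕ→ℚ (suc n) - 0ℚ) * 1ℚ   ≡⟨ solve 1 (λ x → (x :- con 0ℚ) :* con 1ℚ := con 1ℚ :* x) refl (ℕ→ℚ (suc n)) ⟩
  1ℚ * ℕ→ℚ (suc n)          ≡⟨ cong (λ m → 1ℚ * ℕ→ℚ m) (nC1≡n (suc n)) ⟨
  1ℚ * bin (suc n) 1        ∎
  where open ≡-Reasoning
bin-absorb (suc n) (suc k) = begin
  (ℕ→ℚ (suc n) - ℕ→ℚ (suc k)) * bin (suc n) (suc k)
    ≡⟨ cong₂ _*_ (cong₂ _-_ (ℕ→ℚ-suc n) (ℕ→ℚ-suc k)) (bin-pascal n k) ⟩
  (1ℚ + x - (1ℚ + z)) * (bin n k + v)
    ≡⟨ solve 4 (λ x z u v → (con 1ℚ :+ x :- (con 1ℚ :+ z)) :* (u :+ v)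
         := (x :- z) :* u :+ ((x :- (con 1ℚ :+ z)) :* v :+ v)) refl x z (bin n k) v ⟩
  (x - z) * bin n k + ((x - (1ℚ + z)) * v + v)
    ≡⟨ cong₂ _+_ (trans (bin-absorb n k) (cong (_* v) (ℕ→ℚ-suc k)))
         (cong (_+ v) (trans (cong (λ t → (x - t) * v) (sym (ℕ→ℚ-suc k)))
           (trans (bin-absorb n (suc k)) (cong (_* bin n (suc (suc k))) (trans (ℕ→ℚ-suc (suc k)) (cong
                (λ t → 1ℚ + t) (ℕ→ℚ-suc k))))))) ⟩
  (1ℚ + z) * v + ((1ℚ + (1ℚ + z)) * bin n (suc (suc k)) + v)
    ≡⟨ solve 3 (λ z v u → (con 1ℚ :+ z) :* v :+ ((con 1ℚ :+ (con 1ℚ :+ z)) :* u :+ v)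
         := (con 1ℚ :+ (con 1ℚ :+ z)) :* (v :+ u)) refl z v (bin n (suc (suc k))) ⟩
  (1ℚ + (1ℚ + z)) * (v + bin n (suc (suc k)))
    ≡⟨ cong₂ _*_ (trans (ℕ→ℚ-suc (suc k)) (cong (λ t → 1ℚ + t) (ℕ→ℚ-suc k))) (bin-pascal n (suc k)) ⟨
  ℕ→ℚ (suc (suc k)) * bin (suc n) (suc (suc k)) ∎
  where
  open ≡-Reasoning
  x z v : ℚ
  x = ℕ→ℚ n
  z = ℕ→ℚ k
  v = bin n (suc k)

-- As `shift k (bin p) m` is the binomial coefficient of p over m - k, this is `bin-absorb` at m -
-- k, extended to negative values of m - k.
shift-bin-absorb : ∀ k p m → (ℕ→ℚ k + ℕ→ℚ p - ℕ→ℚ m) * shift k (bin p) m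
  ≡ (ℕ→ℚ (suc m) - ℕ→ℚ k) * shift k (bin p) (suc m)
shift-bin-absorb zero    p m = begin
  (0ℚ + ℕ→ℚ p - ℕ→ℚ m) * bin p m       ≡⟨ cong (λ t → (t - ℕ→ℚ m) * bin p m) (+-identityˡ (ℕ→ℚ p)) ⟩
  (ℕ→ℚ p - ℕ→ℚ m) * bin p m            ≡⟨ bin-absorb p m ⟩
  ℕ→ℚ (suc m) * bin p (suc m)          ≡⟨ cong (_* bin p (suc m)) (+-identityʳ (ℕ→ℚ (suc m))) ⟨
  (ℕ→ℚ (suc m) - 0ℚ) * bin p (suc m)   ∎
  where open ≡-Reasoning
-- The boundary case m + 1 = k: the shifted coefficient on the right is 1, but its factor m + 1 - k
-- is zero.
shift-bin-absorb (suc zero)    p zero = trans (*-zeroʳ (ℕ→ℚ 1 + ℕ→ℚ p - 0ℚ)) (sym (*-zeroˡ 1ℚ))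
shift-bin-absorb (suc (suc k)) p zero =
  trans (*-zeroʳ (ℕ→ℚ (suc (suc k)) + ℕ→ℚ p - 0ℚ)) (sym (*-zeroʳ (ℕ→ℚ 1 - ℕ→ℚ (suc (suc k)))))
shift-bin-absorb (suc k) p (suc m) = begin
  (ℕ→ℚ (suc k) + ℕ→ℚ p - ℕ→ℚ (suc m)) * u
    ≡⟨ cong (_* u) (trans (cong₂ (λ s t → s + ℕ→ℚ p - t) (ℕ→ℚ-suc k) (ℕ→ℚ-suc m))
         (solve 3 (λ a b c → con 1ℚ :+ a :+ b :- (con 1ℚ :+ c) := a :+ b :- c) refl (ℕ→ℚ k) (ℕ→ℚ p) (ℕ→ℚ m))) ⟩
  (ℕ→ℚ k + ℕ→ℚ p - ℕ→ℚ m) * u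
    ≡⟨ shift-bin-absorb k p m ⟩
  (ℕ→ℚ (suc m) - ℕ→ℚ k) * v
    ≡⟨ cong (_* v) (trans (cong₂ _-_ (ℕ→ℚ-suc (suc m)) (ℕ→ℚ-suc k))
         (solve 2 (λ a b → con 1ℚ :+ a :- (con 1ℚ :+ b) := a :- b) refl (ℕ→ℚ (suc m)) (ℕ→ℚ k))) ⟨
  (ℕ→ℚ (suc (suc m)) - ℕ→ℚ (suc k)) * v ∎
  where
  open ≡-Reasoning
  u v : ℚ
  u = shift k (bin p) m
  v = shift k (bin p) (suc m)

shift-1-≢ : ∀ i b → i ≢ b → shift i (ℚ[[w]].const 1ℚ) b ≡ 0ℚ
shift-1-≢ zero    zero    i≢b = contradiction refl i≢b
shift-1-≢ zero    (suc b) i≢b = refl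
shift-1-≢ (suc i) zero    i≢b = refl
shift-1-≢ (suc i) (suc b) i≢b = shift-1-≢ i b (λ i≡b → i≢b (cong suc i≡b))

shift-diagonal : ∀ i f → shift i f i ≡ f 0
shift-diagonal zero    f = refl
shift-diagonal (suc i) f = shift-diagonal i f

-- The first factor needs b ≤ i and the second needs i ≤ b, so only i = b survives. This collapses
-- one of the two cyclic correction sums when the other parameter is 0.
bin-shift-bin : ∀ i p b → bin i b * shift i (bin p) b ≡ shift i (ℚ[[w]].const 1ℚ) b
bin-shift-bin i p b with ℕₚ.<-cmp i b
... | tri< i<b i≢b _ = trans (cong (_* shift i (bin p) b) (bin-< i b i<b))
        (trans (*-zeroˡ (shift i (bin p) b)) (sym (shift-1-≢ i b i≢b)))
... | tri≈ _ refl _ = trans (cong₂ _*_ (cong ℕ→ℚ (nCn≡1 b)) (shift-diagonal b (bin p)))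
        (sym (shift-diagonal b (ℚ[[w]].const 1ℚ)))
... | tri> _ i≢b b<i = trans (cong (bin i b *_) (shift-< i (bin p) b b<i))
        (trans (*-zeroʳ (bin i b)) (sym (shift-1-≢ i b i≢b)))

-- Reduction to the case r₁ = 0

module Recurrence (M : ℕ) where

  -- With u = 1/(eᵗ - 1) and D a = u⁽ᵃ⁾/a!, the derivative of D a · D b is (a+1) D (a+1) · D b +
  -- (b+1) D a · D (b+1). The factor on the left arises from differentiating t^(M-a-b).
  Leibniz : (ℕ → ℕ → ℚ) → Set
  Leibniz Ψ = ∀ a b → (ℕ→ℚ M - ℕ→ℚ a - ℕ→ℚ b) * Ψ a b
    ≡ ℕ→ℚ (suc a) * Ψ (suc a) b + ℕ→ℚ (suc b) * Ψ a (suc b)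

  Leibniz-+ : ∀ {Ψ Ω} → Leibniz Ψ → Leibniz Ω → Leibniz (λ a b → Ψ a b + Ω a b)
  Leibniz-+ {Ψ} {Ω} p q a b = trans (*-distribˡ-+ D (Ψ a b) (Ω a b))
    (trans (cong₂ _+_ (p a b) (q a b))
      (solve 6 (λ s t u v x y → s :* u :+ t :* v :+ (s :* x :+ t :* y) := s :* (u :+ x) :+ t :* (v :+ y)) refl
        (ℕ→ℚ (suc a)) (ℕ→ℚ (suc b)) (Ψ (suc a) b) (Ψ a (suc b)) (Ω (suc a) b) (Ω a (suc b))))
    where
    D : ℚ
    D = ℕ→ℚ M - ℕ→ℚ a - ℕ→ℚ b

  Leibniz-* : ∀ x {Ψ} → Leibniz Ψ → Leibniz (λ a b → x * Ψ a b)
  Leibniz-* x {Ψ} p a b = trans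
    (solve 3 (λ d x u → d :* (x :* u) := x :* (d :* u)) refl (ℕ→ℚ M - ℕ→ℚ a - ℕ→ℚ b) x (Ψ a b))
    (trans (cong (x *_) (p a b))
      (solve 5 (λ x s t u v → x :* (s :* u :+ t :* v) := s :* (x :* u) :+ t :* (x :* v)) refl
        x (ℕ→ℚ (suc a)) (ℕ→ℚ (suc b)) (Ψ (suc a) b) (Ψ a (suc b))))

  Leibniz-swap : ∀ {Ψ} → Leibniz Ψ → Leibniz (λ a b → Ψ b a)
  Leibniz-swap {Ψ} p a b = trans
    (solve 4 (λ m x y u → (m :- x :- y) :* u := (m :- y :- x) :* u) refl (ℕ→ℚ M) (ℕ→ℚ a) (ℕ→ℚ b) (Ψ b a))
    (trans (p b a) (solve 2 (λ u v → u :+ v := v :+ u)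
         refl (ℕ→ℚ (suc b) * Ψ (suc b) a) (ℕ→ℚ (suc a) * Ψ b (suc a))))

  Leibniz-sumBelow : ∀ n {Ψ : ℕ → ℕ → ℕ → ℚ} → (∀ i → i < n → Leibniz (Ψ i)) →
    Leibniz (λ a b → sumBelow n (λ i → Ψ i a b))
  Leibniz-sumBelow zero    p a b = trans (*-zeroʳ (ℕ→ℚ M - ℕ→ℚ a - ℕ→ℚ b))
    (solve 2 (λ x y → con 0ℚ := x :* con 0ℚ :+ y :* con 0ℚ) refl (ℕ→ℚ (suc a)) (ℕ→ℚ (suc b)))
  Leibniz-sumBelow (suc n) {Ψ} p = Leibniz-+ {λ a b → sumBelow n (λ i → Ψ i a b)} {Ψ n}
    (Leibniz-sumBelow n (λ i i<n → p i (ℕₚ.m<n⇒m<1+n i<n))) (p n (ℕₚ.n<1+n n))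

  binProduct : ℕ → ℕ → ℕ → ℚ
  binProduct i a b = bin i a * bin (M ∸ i) b

  -- The summand of the correction sum, with its range built in: `bin i a` vanishes for i < a and
  -- the shifted row for i > a + b. All sums can thus run over 0 ≤ i ≤ M, independently of a and b,
  -- as a termwise recurrence requires.
  shiftedTerm : ℕ → ℕ → ℕ → ℚ
  shiftedTerm i a b = signPow a * (bin i a * shift i (bin (M ∸ i)) (a ℕ.+ b))

  signedBin : ℕ → ℕ → ℚ
  signedBin a b = signPow b * bin (suc M) a

  total : ℕ → ℕ → ℚ
  total a b = bin (suc M) (suc (a ℕ.+ b))

  split-M : ∀ i → i ≤ M → ℕ→ℚ M ≡ ℕ→ℚ i + ℕ→ℚ (M ∸ i)
  split-M i i≤M = trans (cong ℕ→ℚ (sym (ℕₚ.m+[n∸m]≡n i≤M))) (ℕ→ℚ-+ i (M ∸ i))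

  -- Split M - a - b as (i - a) + (M - i - b) and absorb each part into its own binomial
  -- coefficient.
  binProduct-Leibniz : ∀ i → i ≤ M → Leibniz (binProduct i)
  binProduct-Leibniz i i≤M a b = begin
    (ℕ→ℚ M - ℕ→ℚ a - ℕ→ℚ b) * (bin i a * bin p b)
      ≡⟨ cong (λ m → (m - ℕ→ℚ a - ℕ→ℚ b) * (bin i a * bin p b)) (split-M i i≤M) ⟩
    (ℕ→ℚ i + ℕ→ℚ p - ℕ→ℚ a - ℕ→ℚ b) * (bin i a * bin p b)
      ≡⟨ solve 6 (λ i p a b u v → (i :+ p :- a :- b) :* (u :* v) := ((i :- a) :* u) :* v :+ u :*
           ((p :- b) :* v)) refl
           (ℕ→ℚ i) (ℕ→ℚ p) (ℕ→ℚ a) (ℕ→ℚ b) (bin i a) (bin p b) ⟩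
    ((ℕ→ℚ i - ℕ→ℚ a) * bin i a) * bin p b + bin i a * ((ℕ→ℚ p - ℕ→ℚ b) * bin p b)
      ≡⟨ cong₂ (λ s t → s * bin p b + bin i a * t) (bin-absorb i a) (bin-absorb p b) ⟩
    (ℕ→ℚ (suc a) * bin i (suc a)) * bin p b + bin i a * (ℕ→ℚ (suc b) * bin p (suc b))
      ≡⟨ solve 6 (λ s t u v x y → (s :* u) :* v :+ x :* (t :* y) := s :* (u :* v) :+ t :* (x :* y)) refl
           (ℕ→ℚ (suc a)) (ℕ→ℚ (suc b)) (bin i (suc a)) (bin p b) (bin i a) (bin p (suc b)) ⟩
    ℕ→ℚ (suc a) * (bin i (suc a) * bin p b) + ℕ→ℚ (suc b) * (bin i a * bin p (suc b)) ∎
    where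
    open ≡-Reasoning
    p : ℕ
    p = M ∸ i

  -- Absorption in the shifted row turns M - a - b into a + b + 1 - i = (b + 1) - (i - a). The first
  -- part gives the neighbour at b + 1; the second is absorbed by `bin i a`, its minus sign being
  -- the change from `signPow a` to `signPow (suc a)`.
  shiftedTerm-Leibniz : ∀ i → i ≤ M → Leibniz (shiftedTerm i)
  shiftedTerm-Leibniz i i≤M a b = begin
    (ℕ→ℚ M - ℕ→ℚ a - ℕ→ℚ b) * (s * (u * S (a ℕ.+ b)))
      ≡⟨ cong (λ m → (m - ℕ→ℚ a - ℕ→ℚ b) * (s * (u * S (a ℕ.+ b)))) (split-M i i≤M) ⟩
    (ℕ→ℚ i + ℕ→ℚ p - ℕ→ℚ a - ℕ→ℚ b) * (s * (u * S (a ℕ.+ b)))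
      ≡⟨ solve 7 (λ i p a b s u v → (i :+ p :- a :- b) :* (s :* (u :* v)) := s :* (u :* ((i :+ p :-
           (a :+ b)) :* v))) refl
           (ℕ→ℚ i) (ℕ→ℚ p) (ℕ→ℚ a) (ℕ→ℚ b) s u (S (a ℕ.+ b)) ⟩
    s * (u * ((ℕ→ℚ i + ℕ→ℚ p - (ℕ→ℚ a + ℕ→ℚ b)) * S (a ℕ.+ b)))
      ≡⟨ cong (λ m → s * (u * ((ℕ→ℚ i + ℕ→ℚ p - m) * S (a ℕ.+ b)))) (ℕ→ℚ-+ a b) ⟨
    s * (u * ((ℕ→ℚ i + ℕ→ℚ p - ℕ→ℚ (a ℕ.+ b)) * S (a ℕ.+ b)))
      ≡⟨ cong (λ m → s * (u * m)) (shift-bin-absorb i p (a ℕ.+ b)) ⟩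
    s * (u * ((ℕ→ℚ (suc (a ℕ.+ b)) - ℕ→ℚ i) * V))
      ≡⟨ cong (λ m → s * (u * ((m - ℕ→ℚ i) * V))) (trans (cong ℕ→ℚ (sym (ℕₚ.+-suc a b))) (ℕ→ℚ-+ a (suc b))) ⟩
    s * (u * ((ℕ→ℚ a + ℕ→ℚ (suc b) - ℕ→ℚ i) * V))
      ≡⟨ solve 6 (λ s u a b i v → s :* (u :* ((a :+ b :- i) :* v)) := (:- s) :*
           (((i :- a) :* u) :* v) :+ b :* (s :* (u :* v))) refl
           s u (ℕ→ℚ a) (ℕ→ℚ (suc b)) (ℕ→ℚ i) V ⟩
    - s * (((ℕ→ℚ i - ℕ→ℚ a) * u) * V) + ℕ→ℚ (suc b) * (s * (u * V))
      ≡⟨ cong₂ (λ x y → - s * (x * V) + ℕ→ℚ (suc b) * (s * (u * S y))) (bin-absorb i a) (sym (ℕₚ.+-suc a b)) ⟩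
    - s * ((ℕ→ℚ (suc a) * bin i (suc a)) * V) + ℕ→ℚ (suc b) * (s * (u * S (a ℕ.+ suc b)))
      ≡⟨ cong (_+ ℕ→ℚ (suc b) * (s * (u * S (a ℕ.+ suc b))))
           (solve 4 (λ s x y v → s :* ((x :* y) :* v) := x :* (s :* (y :* v)))
                refl (- s) (ℕ→ℚ (suc a)) (bin i (suc a)) V) ⟩
    ℕ→ℚ (suc a) * (- s * (bin i (suc a) * V)) + ℕ→ℚ (suc b) * (s * (u * S (a ℕ.+ suc b))) ∎
    where
    open ≡-Reasoning
    p : ℕ
    p = M ∸ i
    S : ℕ → ℚ
    S = shift i (bin p)
    s u V : ℚ
    s = signPow a
    u = bin i a
    V = S (suc (a ℕ.+ b))

  -- Split M - a - b as (M + 1 - a) - (b + 1): the first part is absorbed, the second accounts for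
  -- the change of sign.
  signedBin-Leibniz : Leibniz signedBin
  signedBin-Leibniz a b = begin
    (ℕ→ℚ M - ℕ→ℚ a - ℕ→ℚ b) * (s * u)
      ≡⟨ solve 5 (λ m a b s u → (m :- a :- b) :* (s :* u) := s :* ((con 1ℚ :+ m :- a) :* u) :+
           (con 1ℚ :+ b) :* ((:- s) :* u)) refl
           (ℕ→ℚ M) (ℕ→ℚ a) (ℕ→ℚ b) s u ⟩
    s * ((1ℚ + ℕ→ℚ M - ℕ→ℚ a) * u) + (1ℚ + ℕ→ℚ b) * (- s * u)
      ≡⟨ cong₂ (λ x y → s * ((x - ℕ→ℚ a) * u) + y * (- s * u)) (ℕ→ℚ-suc M) (ℕ→ℚ-suc b) ⟨
    s * ((ℕ→ℚ (suc M) - ℕ→ℚ a) * u) + ℕ→ℚ (suc b) * (- s * u)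
      ≡⟨ cong (λ x → s * x + ℕ→ℚ (suc b) * (- s * u)) (bin-absorb (suc M) a) ⟩
    s * (ℕ→ℚ (suc a) * bin (suc M) (suc a)) + ℕ→ℚ (suc b) * (- s * u)
      ≡⟨ cong (_+ ℕ→ℚ (suc b) * (- s * u)) (solve 3 (λ s x y → s :* (x :* y) := x :* (s :* y))
           refl s (ℕ→ℚ (suc a)) (bin (suc M) (suc a))) ⟩
    ℕ→ℚ (suc a) * (s * bin (suc M) (suc a)) + ℕ→ℚ (suc b) * (- s * u) ∎
    where
    open ≡-Reasoning
    s u : ℚ
    s = signPow b
    u = bin (suc M) a

  -- Only a + b matters here: absorption yields the factor a + b + 2 = (a + 1) + (b + 1), and both
  -- neighbours are equal.
  total-Leibniz : Leibniz total
  total-Leibniz a b = begin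
    (ℕ→ℚ M - ℕ→ℚ a - ℕ→ℚ b) * u
      ≡⟨ solve 4 (λ m a b u → (m :- a :- b) :* u := (con 1ℚ :+ m :- (con 1ℚ :+ (a :+ b))) :* u)
           refl (ℕ→ℚ M) (ℕ→ℚ a) (ℕ→ℚ b) u ⟩
    (1ℚ + ℕ→ℚ M - (1ℚ + (ℕ→ℚ a + ℕ→ℚ b))) * u
      ≡⟨ cong₂ (λ x y → (x - y) * u) (sym (ℕ→ℚ-suc M)) (sym (trans (ℕ→ℚ-suc (a ℕ.+ b)) (cong
           (λ x → 1ℚ + x) (ℕ→ℚ-+ a b)))) ⟩
    (ℕ→ℚ (suc M) - ℕ→ℚ (suc (a ℕ.+ b))) * u
      ≡⟨ bin-absorb (suc M) (suc (a ℕ.+ b)) ⟩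
    ℕ→ℚ (suc (suc (a ℕ.+ b))) * v
      ≡⟨ cong (_* v) (trans (cong (λ k → ℕ→ℚ (suc k)) (sym (ℕₚ.+-suc a b))) (ℕ→ℚ-+ (suc a) (suc b))) ⟩
    (ℕ→ℚ (suc a) + ℕ→ℚ (suc b)) * v
      ≡⟨ *-distribʳ-+ v (ℕ→ℚ (suc a)) (ℕ→ℚ (suc b)) ⟩
    ℕ→ℚ (suc a) * v + ℕ→ℚ (suc b) * v
      ≡⟨ cong (λ k → ℕ→ℚ (suc a) * v + ℕ→ℚ (suc b) * bin (suc M) (suc k)) (sym (ℕₚ.+-suc a b)) ⟩
    ℕ→ℚ (suc a) * v + ℕ→ℚ (suc b) * total a (suc b) ∎
    where
    open ≡-Reasoning
    u v : ℚ
    u = total a b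
    v = bin (suc M) (suc (suc (a ℕ.+ b)))

  -- Summation indices are shifted throughout: i = k - 1 and M = 2n - 2.
  q : ℕ → ℚ
  q i = bernCoeff (suc i) * bernCoeff (suc (M ∸ i))

  -- Left-hand side minus right-hand side of the theorem, divided by a! b!.
  defect : ℕ → ℕ → ℚ
  defect a b = sumBelow (suc M) (λ i → q i * (binProduct i a b + (shiftedTerm i a b + shiftedTerm i b a)))
    + bernCoeff (suc (suc M)) * (total a b + (signedBin a b + signedBin b a))

  defect-Leibniz : Leibniz defect
  defect-Leibniz = Leibniz-+ {λ a b → sumBelow (suc M) (λ i → inner i a b)} {λ a b → bernCoeff (suc
       (suc M)) * outer a b}
    (Leibniz-sumBelow (suc M) {inner} (λ i i≤M →
      Leibniz-* (q i) (Leibniz-+ (binProduct-Leibniz i (ℕₚ.≤-pred i≤M))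
        (Leibniz-+ (shiftedTerm-Leibniz i (ℕₚ.≤-pred i≤M)) (Leibniz-swap {shiftedTerm i}
             (shiftedTerm-Leibniz i (ℕₚ.≤-pred i≤M)))))))
    (Leibniz-* (bernCoeff (suc (suc M))) {outer} (Leibniz-+ total-Leibniz (Leibniz-+ signedBin-Leibniz
         (Leibniz-swap {signedBin} signedBin-Leibniz))))
    where
    inner : ℕ → ℕ → ℕ → ℚ
    inner i a b = q i * (binProduct i a b + (shiftedTerm i a b + shiftedTerm i b a))
    outer : ℕ → ℕ → ℚ
    outer a b = total a b + (signedBin a b + signedBin b a)

  -- The recurrence is solved for Ψ (a+1) b. Of the two values this involves, Ψ a (b+1) has the same
  -- index sum as the target and Ψ a b a smaller one, so the bound by M is inherited.
  Leibniz-vanish : ∀ {Ψ} → Leibniz Ψ → (∀ b → b < M → Ψ 0 b ≡ 0ℚ) → ∀ a b → a ℕ.+ b < M → Ψ a b ≡ 0ℚ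
  Leibniz-vanish         p base zero    b lt = base b lt
  Leibniz-vanish {Ψ} p base (suc a) b lt = begin
    x                                         ≡⟨ *-identityˡ x ⟨
    1ℚ * x                                    ≡⟨ cong (_* x) (recip-inverse a) ⟨
    recip a * ℚ[[w]].fromℕ (suc a) * x        ≡⟨ cong (λ t → recip a * t * x) (fromℕ≡ℕ→ℚ (suc a)) ⟩
    recip a * ℕ→ℚ (suc a) * x
      ≡⟨ solve 4 (λ r s x t → r :* s :* x := r :* ((s :* x :+ t) :- t))
           refl (recip a) (ℕ→ℚ (suc a)) x (ℕ→ℚ (suc b) * Ψ a (suc b)) ⟩
    recip a * (ℕ→ℚ (suc a) * x + ℕ→ℚ (suc b) * Ψ a (suc b) - ℕ→ℚ (suc b) * Ψ a (suc b))
      ≡⟨ cong (λ t → recip a * (t - ℕ→ℚ (suc b) * Ψ a (suc b))) (p a b) ⟨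
    recip a * (D * Ψ a b - ℕ→ℚ (suc b) * Ψ a (suc b))
      ≡⟨ cong₂ (λ s t → recip a * (D * s - ℕ→ℚ (suc b) * t))
           (Leibniz-vanish {Ψ} p base a b (ℕₚ.<-trans (ℕₚ.n<1+n (a ℕ.+ b)) lt))
           (Leibniz-vanish {Ψ} p base a (suc b) (ℕₚ.≤-trans (ℕₚ.≤-reflexive (cong suc (ℕₚ.+-suc a b))) lt)) ⟩
    recip a * (D * 0ℚ - ℕ→ℚ (suc b) * 0ℚ)
      ≡⟨ solve 3 (λ r d s → r :* (d :* con 0ℚ :- s :* con 0ℚ) := con 0ℚ) refl (recip a) D (ℕ→ℚ (suc b)) ⟩
    0ℚ ∎
    where
    open ≡-Reasoning
    x D : ℚ
    x = Ψ (suc a) b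
    D = ℕ→ℚ M - ℕ→ℚ a - ℕ→ℚ b

-- Parity and the vanishing of the defect

module Vanishing (M : ℕ) (even : signPow M ≡ 1ℚ) where
  open Recurrence M

  neg-cancel : ∀ {x} → - x ≡ 1ℚ → x ≡ - 1ℚ
  neg-cancel {x} p = trans (solve 1 (λ x → x := :- (:- x)) refl x) (cong -_ p)

  bernCoeff-suc-even : ∀ k → 0 < k → signPow k ≡ 1ℚ → bernCoeff (suc k) ≡ 0ℚ
  bernCoeff-suc-even (suc k) _ p = bernCoeff-odd k (neg-cancel p)

  -- Off the diagonal the delta vanishes. On it, an odd b kills 1 + (-1)ᵇ, and an even b makes M - b
  -- even and positive, so that `bernCoeff (suc (M ∸ b))` has odd index at least 3.
  diagonalTerm-zero : ∀ b i → b < M →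
    (1ℚ + signPow b) * (q i * shift i (ℚ[[w]].const 1ℚ) b) ≡ 0ℚ
  diagonalTerm-zero b i b<M with i ℕ.≟ b
  ... | no i≢b = trans (cong (λ x → (1ℚ + signPow b) * (q i * x)) (shift-1-≢ i b i≢b))
        (solve 2 (λ x y → x :* (y :* con 0ℚ) := con 0ℚ) refl (1ℚ + signPow b) (q i))
  ... | yes refl with signPow-±1 b
  ...   | inj₂ odd = trans (cong (λ x → (1ℚ + x) * (q b * shift b (ℚ[[w]].const 1ℚ) b)) odd)
          (*-zeroˡ (q b * shift b (ℚ[[w]].const 1ℚ) b))
  ...   | inj₁ evenb = trans
          (cong (λ x → (1ℚ + signPow b) * (bernCoeff (suc b) * x * shift b (ℚ[[w]].const 1ℚ) b))
            (bernCoeff-suc-even (M ∸ b) (ℕₚ.m<n⇒0<n∸m b<M) evenM∸b))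
          (solve 3 (λ x y z → x :* (y :* con 0ℚ :* z) := con 0ℚ) refl
            (1ℚ + signPow b) (bernCoeff (suc b)) (shift b (ℚ[[w]].const 1ℚ) b))
    where
    open ≡-Reasoning
    evenM∸b : signPow (M ∸ b) ≡ 1ℚ
    evenM∸b = begin
      signPow (M ∸ b)                ≡⟨ *-identityˡ _ ⟨
      1ℚ * signPow (M ∸ b)           ≡⟨ cong (_* signPow (M ∸ b)) evenb ⟨
      signPow b * signPow (M ∸ b)    ≡⟨ signPow-+ b (M ∸ b) ⟨
      signPow (b ℕ.+ (M ∸ b))        ≡⟨ cong signPow (ℕₚ.m+[n∸m]≡n (ℕₚ.<⇒≤ b<M)) ⟩
      signPow M                      ≡⟨ even ⟩
      1ℚ                             ∎

  -- For a = 0 the swapped correction sum collapses to (-1)ᵇ Σ₃, and everything else is the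
  -- right-hand side of `baseIdentity`, that is Σ₃ itself. What remains is (1 + (-1)ᵇ) Σ₃.
  defect-base : ∀ b → b < M → defect 0 b ≡ 0ℚ
  defect-base b b<M = begin
    defect 0 b
      ≡⟨ cong₂ _+_ sums (cong (cN *_) (solve 3 (λ t s u → t :+ (s :* con 1ℚ :+ con 1ℚ :* u) := t :+
           (s :+ u)) refl
           (bin (suc M) (suc b)) s (bin (suc M) b))) ⟩
    Σ₁ + Σ₂ + s * Σ₃ + cN * (bin (suc M) (suc b) + (s + bin (suc M) b))
      -- The inserted zero multiple of `bin M b` is to become the term with `bernCoeff (suc M)`,
      -- which vanishes because M is even and positive.
      ≡⟨ solve 8 (λ a b s c n t u d → a :+ b :+ s :* c :+ n :* (t :+ (s :+ u))
             := s :* c :+ ((n :* u :+ n :* s :+ a) :+ (n :* t :+ b) :+ con 0ℚ :* d)) refl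
           Σ₁ Σ₂ s Σ₃ cN (bin (suc M) (suc b)) (bin (suc M) b) (bin M b) ⟩
    s * Σ₃ + ((cN * bin (suc M) b + cN * s + Σ₁) + (cN * bin (suc M) (suc b) + Σ₂) + 0ℚ * bin M b)
      ≡⟨ cong (λ x → s * Σ₃ + ((cN * bin (suc M) b + cN * s + Σ₁) + (cN * bin (suc M)
           (suc b) + Σ₂) + x * bin M b))
           (bernCoeff-suc-even M (ℕₚ.≤-<-trans z≤n b<M) even) ⟨
    s * Σ₃ + ((cN * bin (suc M) b + cN * s + Σ₁) + (cN * bin (suc M) (suc b) + Σ₂) + bernCoeff
         (suc M) * bin M b)
      ≡⟨ cong (λ x → s * Σ₃ + x) (Base.baseIdentity M b (ℕₚ.<⇒≤ b<M)) ⟨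
    s * Σ₃ + Σ₃
      ≡⟨ solve 2 (λ s x → s :* x :+ x := (con 1ℚ :+ s) :* x) refl s Σ₃ ⟩
    (1ℚ + s) * Σ₃
      ≡⟨ sumBelow-* (suc M) (1ℚ + s) f₃ ⟨
    sumBelow (suc M) (λ i → (1ℚ + s) * f₃ i)
      ≡⟨ sumBelow-zero (suc M) (λ i _ → diagonalTerm-zero b i b<M) ⟩
    0ℚ ∎
    where
    open ≡-Reasoning
    s cN : ℚ
    s = signPow b
    cN = bernCoeff (suc (suc M))
    f₁ f₂ f₃ : ℕ → ℚ
    f₁ i = q i * bin (M ∸ i) b
    f₂ i = q i * shift i (bin (M ∸ i)) b
    f₃ i = q i * shift i (ℚ[[w]].const 1ℚ) b
    Σ₁ Σ₂ Σ₃ : ℚ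
    Σ₁ = sumBelow (suc M) f₁
    Σ₂ = sumBelow (suc M) f₂
    Σ₃ = sumBelow (suc M) f₃

    term : ∀ i → q i * (binProduct i 0 b + (shiftedTerm i 0 b + shiftedTerm i b 0)) ≡ f₁ i + f₂ i + s * f₃ i
    term i = begin
      q i * (1ℚ * u + (1ℚ * (1ℚ * v) + s * (bin i b * shift i (bin (M ∸ i)) (b ℕ.+ 0))))
        ≡⟨ cong (λ x → q i * (1ℚ * u + (1ℚ * (1ℚ * v) + s * x)))
             (trans (cong (λ k → bin i b * shift i (bin (M ∸ i)) k) (ℕₚ.+-identityʳ b)) (bin-shift-bin i
                  (M ∸ i) b)) ⟩
      q i * (1ℚ * u + (1ℚ * (1ℚ * v) + s * x))
        ≡⟨ solve 5 (λ q u v s x → q :* (con 1ℚ :* u :+ (con 1ℚ :*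
             (con 1ℚ :* v) :+ s :* x)) := q :* u :+ q :* v :+ s :* (q :* x)) refl
             (q i) u v s x ⟩
      f₁ i + f₂ i + s * f₃ i ∎
      where
      u v x : ℚ
      u = bin (M ∸ i) b
      v = shift i (bin (M ∸ i)) b
      x = shift i (ℚ[[w]].const 1ℚ) b

    sums : sumBelow (suc M) (λ i → q i * (binProduct i 0 b +
         (shiftedTerm i 0 b + shiftedTerm i b 0))) ≡ Σ₁ + Σ₂ + s * Σ₃
    sums = trans (sumBelow-cong (suc M) (λ i _ → term i))
      (trans (sumBelow-+ (suc M) (λ i → f₁ i + f₂ i) (λ i → s * f₃ i))
        (cong₂ _+_ (sumBelow-+ (suc M) f₁ f₂) (sumBelow-* (suc M) s f₃)))

  defect-zero : ∀ a b → a ℕ.+ b < M → defect a b ≡ 0ℚ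
  defect-zero = Leibniz-vanish {defect} defect-Leibniz defect-base

-- From sums over the full range to the sums of the theorem

sumBelow-split : ∀ p q f → sumBelow (p ℕ.+ q) f ≡ sumBelow p f + sumBelow q (λ i → f (p ℕ.+ i))
sumBelow-split p zero    f = trans (cong (λ n → sumBelow n f) (ℕₚ.+-identityʳ p)) (sym (+-identityʳ
     (sumBelow p f)))
sumBelow-split p (suc q) f = trans (cong (λ n → sumBelow n f) (ℕₚ.+-suc p q))
  (trans (cong (_+ f (p ℕ.+ q)) (sumBelow-split p q f)) (+-assoc (sumBelow p f) _ _))

sumBelow-window : ∀ p q {L} f → p ℕ.+ q ≤ L → (∀ i → i < p → f i ≡ 0ℚ) →
  (∀ i → p ℕ.+ q ≤ i → i < L → f i ≡ 0ℚ) → sumBelow L f ≡ sumBelow q (λ i → f (p ℕ.+ i))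
sumBelow-window p q {L} f p+q≤L below above = begin
  sumBelow L f
    ≡⟨ cong (λ n → sumBelow n f) (ℕₚ.m+[n∸m]≡n p+q≤L) ⟨
  sumBelow (p ℕ.+ q ℕ.+ r) f
    ≡⟨ sumBelow-split (p ℕ.+ q) r f ⟩
  sumBelow (p ℕ.+ q) f + sumBelow r (λ i → f (p ℕ.+ q ℕ.+ i))
    ≡⟨ cong₂ _+_ (sumBelow-split p q f) (sumBelow-zero r (λ i i<r → above (p ℕ.+ q ℕ.+ i) (ℕₚ.m≤m+n (p ℕ.+ q) i)
         (ℕₚ.<-≤-trans (ℕₚ.+-monoʳ-< (p ℕ.+ q) i<r) (ℕₚ.≤-reflexive (ℕₚ.m+[n∸m]≡n p+q≤L))))) ⟩
  sumBelow p f + W + 0ℚ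
    ≡⟨ cong (λ x → x + W + 0ℚ) (sumBelow-zero p below) ⟩
  0ℚ + W + 0ℚ
    ≡⟨ trans (+-identityʳ (0ℚ + W)) (+-identityˡ W) ⟩
  W ∎
  where
  open ≡-Reasoning
  r : ℕ
  r = L ∸ (p ℕ.+ q)
  W : ℚ
  W = sumBelow q (λ i → f (p ℕ.+ i))

shift-≤ : ∀ k f m → k ≤ m → shift k f m ≡ f (m ∸ k)
shift-≤ zero    f m       _         = refl
shift-≤ (suc k) f (suc m) (s≤s k≤m) = shift-≤ k f m k≤m

prod1To-bin : ∀ i r → prod1To r (λ a → ℤ→ℚ (+ suc i ℤ.- + a)) ≡ ℕ→ℚ (r !) * bin i r
prod1To-bin i zero    = refl
prod1To-bin i (suc r) = begin
  prod1To r (λ a → ℤ→ℚ (+ suc i ℤ.- + a)) * ℤ→ℚ (+ suc i ℤ.- + suc r)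
    ≡⟨ cong₂ _*_ (prod1To-bin i r) (trans (ℤ→ℚ-+ (+ suc i) (ℤ.- + suc r)) (cong (λ x → ℕ→ℚ (suc i) + x)
         (ℤ→ℚ-neg (suc r)))) ⟩
  ℕ→ℚ (r !) * bin i r * (ℕ→ℚ (suc i) - ℕ→ℚ (suc r))
    ≡⟨ cong₂ (λ x y → ℕ→ℚ (r !) * bin i r * (x - y)) (ℕ→ℚ-suc i) (ℕ→ℚ-suc r) ⟩
  ℕ→ℚ (r !) * bin i r * (1ℚ + ℕ→ℚ i - (1ℚ + ℕ→ℚ r))
    ≡⟨ solve 4 (λ f u x y → f :* u :* (con 1ℚ :+ x :- (con 1ℚ :+ y)) := f :* ((x :- y) :* u))
         refl (ℕ→ℚ (r !)) (bin i r) (ℕ→ℚ i) (ℕ→ℚ r) ⟩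
  ℕ→ℚ (r !) * ((ℕ→ℚ i - ℕ→ℚ r) * bin i r)
    ≡⟨ cong (ℕ→ℚ (r !) *_) (bin-absorb i r) ⟩
  ℕ→ℚ (r !) * (ℕ→ℚ (suc r) * bin i (suc r))
    ≡⟨ solve 3 (λ f s u → f :* (s :* u) := s :* f :* u) refl (ℕ→ℚ (r !)) (ℕ→ℚ (suc r)) (bin i (suc r)) ⟩
  ℕ→ℚ (suc r) * ℕ→ℚ (r !) * bin i (suc r)
    ≡⟨ cong (_* bin i (suc r)) (ℕ→ℚ-* (suc r) (r !)) ⟨
  ℕ→ℚ (suc r !) * bin i (suc r) ∎
  where open ≡-Reasoning

suc-∸ : ∀ {M i} → i ≤ M → suc M ∸ i ≡ suc (M ∸ i)
suc-∸ = ℕₚ.+-∸-assoc 1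

module Summation (M : ℕ) (even : signPow M ≡ 1ℚ) (r₁ r₂ : ℕ) (r₁+r₂<M : r₁ ℕ.+ r₂ < M) where
  open Recurrence M
  open Vanishing M even

  N : ℕ
  N = suc (suc M)

  summand : ℕ → ℚ
  summand k = (B k ÷! k) * (B (N ∸ k) ÷! (N ∸ k))
              * prod1To r₁ (λ a → ℤ→ℚ (+ k ℤ.- + a))
              * prod1To r₂ (λ b → ℤ→ℚ (+ (N ∸ k) ℤ.- + b))

  fac : ℚ
  fac = ℕ→ℚ (r₁ ! ℕ.* r₂ !)

  term : ℕ → ℚ
  term i = fac * (q i * binProduct i r₁ r₂)

  summand-suc : ∀ i → i ≤ M → summand (suc i) ≡ term i
  summand-suc i i≤M = begin
    summand (suc i)
      ≡⟨ cong (λ j → (B (suc i) ÷! suc i) * (B j ÷! j) * P₁ * prod1To r₂ (λ b → ℤ→ℚ (+ j ℤ.- + b)))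
           (suc-∸ i≤M) ⟩
    (B (suc i) ÷! suc i) * (B (suc p) ÷! suc p) * P₁ * prod1To r₂ (λ b → ℤ→ℚ (+ suc p ℤ.- + b))
      ≡⟨ cong₂ _*_ (cong₂ _*_ (cong₂ _*_ (B÷! (suc i)) (B÷! (suc p))) (prod1To-bin i r₁)) (prod1To-bin p r₂) ⟩
    q i * (ℕ→ℚ (r₁ !) * bin i r₁) * (ℕ→ℚ (r₂ !) * bin p r₂)
      ≡⟨ solve 5 (λ q f u g v → q :* (f :* u) :* (g :* v) := f :* g :* (q :* (u :* v))) refl
           (q i) (ℕ→ℚ (r₁ !)) (bin i r₁) (ℕ→ℚ (r₂ !)) (bin p r₂) ⟩
    ℕ→ℚ (r₁ !) * ℕ→ℚ (r₂ !) * (q i * binProduct i r₁ r₂)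
      ≡⟨ cong (_* (q i * binProduct i r₁ r₂)) (ℕ→ℚ-* (r₁ !) (r₂ !)) ⟨
    term i ∎
    where
    open ≡-Reasoning
    p : ℕ
    p = M ∸ i
    P₁ : ℚ
    P₁ = prod1To r₁ (λ a → ℤ→ℚ (+ suc i ℤ.- + a))

  lhs mid : ℚ
  lhs = sumFromTo 1 (N ∸ 1) summand
  mid = sumFromTo (suc r₁) (N ∸ r₂ ∸ 1) summand

  -- With i = k - 1, the first product vanishes for i < r₁ and the second for M - i < r₂.
  lhs≡mid : lhs ≡ mid
  lhs≡mid = trans (sumBelow-window r₁ (suc M ∸ r₂ ∸ r₁) (λ i → summand (suc i))
      (ℕₚ.≤-trans (ℕₚ.≤-reflexive r₁+len) (ℕₚ.m∸n≤m (suc M) r₂)) below above)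
    (cong (λ L → sumBelow (L ∸ r₁) (λ i → summand (suc r₁ ℕ.+ i))) len)
    where
    r₁≤ : r₁ ≤ suc M ∸ r₂
    r₁≤ = ℕₚ.≤-trans (ℕₚ.≤-reflexive (sym (ℕₚ.m+n∸n≡m r₁ r₂)))
      (ℕₚ.∸-monoˡ-≤ r₂ (ℕₚ.≤-trans (ℕₚ.<⇒≤ r₁+r₂<M) (ℕₚ.n≤1+n M)))

    r₁+len : r₁ ℕ.+ (suc M ∸ r₂ ∸ r₁) ≡ suc M ∸ r₂
    r₁+len = ℕₚ.m+[n∸m]≡n r₁≤

    len : suc M ∸ r₂ ≡ N ∸ r₂ ∸ 1
    len = trans (cong (N ∸_) (ℕₚ.+-comm 1 r₂)) (sym (ℕₚ.∸-+-assoc N r₂ 1))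

    below : ∀ i → i < r₁ → summand (suc i) ≡ 0ℚ
    below i i<r₁ = trans (summand-suc i (ℕₚ.<⇒≤ (ℕₚ.<-trans i<r₁ (ℕₚ.≤-<-trans (ℕₚ.m≤m+n r₁ r₂) r₁+r₂<M))))
      (trans (cong (λ x → fac * (q i * (x * bin (M ∸ i) r₂))) (bin-< i r₁ i<r₁))
        (solve 3 (λ f q u → f :* (q :* (con 0ℚ :* u)) := con 0ℚ) refl fac (q i) (bin (M ∸ i) r₂)))

    above : ∀ i → r₁ ℕ.+ (suc M ∸ r₂ ∸ r₁) ≤ i → i < suc M → summand (suc i) ≡ 0ℚ
    above i le (s≤s i≤M) = trans (summand-suc i i≤M)
      (trans (cong (λ x → fac * (q i * (bin i r₁ * x))) (bin-< (M ∸ i) r₂ M∸i<r₂))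
        (solve 3 (λ f q u → f :* (q :* (u :* con 0ℚ)) := con 0ℚ) refl fac (q i) (bin i r₁)))
      where
      M∸i<r₂ : M ∸ i < r₂
      M∸i<r₂ = ℕₚ.≤-trans (ℕₚ.≤-reflexive (sym (suc-∸ i≤M)))
        (ℕₚ.m≤n+o⇒m∸n≤o (suc M) i (ℕₚ.≤-trans (ℕₚ.m≤n+m∸n (suc M) r₂)
          (ℕₚ.≤-trans (ℕₚ.+-monoʳ-≤ r₂ (ℕₚ.≤-trans (ℕₚ.≤-reflexive (sym r₁+len)) le)) (ℕₚ.≤-reflexive
               (ℕₚ.+-comm r₂ i)))))

  correction : ℕ → ℕ → ℚ
  correction s₁ s₂ = signPow s₁ *
    sumFromTo (suc s₁) (s₁ ℕ.+ s₂ ℕ.+ 1) (λ k →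
      ℕ→ℚ ((N ∸ 1 ∸ k) C (s₁ ℕ.+ s₂ ℕ.+ 1 ∸ k))
      * ℕ→ℚ ((k ∸ 1) C s₁)
      * (B k ÷! k) * (B (N ∸ k) ÷! (N ∸ k)))

  -- The bound on a + b places the window a ≤ i ≤ a + b inside 0 ≤ i ≤ M; outside it the terms of
  -- `shiftedTerm` are zero.
  correction-sum : ∀ a b → a ℕ.+ b < M → correction a b ≡ sumBelow (suc M) (λ i → q i * shiftedTerm i a b)
  correction-sum a b a+b<M = begin
    signPow a * sumBelow (a ℕ.+ b ℕ.+ 1 ∸ a) (λ i → h (a ℕ.+ b ℕ.+ 1) (a ℕ.+ i))
      ≡⟨ cong (λ m → signPow a * sumBelow (m ∸ a) (λ i → h m (a ℕ.+ i))) (trans (ℕₚ.+-assoc a b 1) (cong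
           (a ℕ.+_) (ℕₚ.+-comm b 1))) ⟩
    signPow a * sumBelow (a ℕ.+ suc b ∸ a) (λ i → h (a ℕ.+ suc b) (a ℕ.+ i))
      ≡⟨ cong (λ m → signPow a * sumBelow m (λ i → h (a ℕ.+ suc b) (a ℕ.+ i))) (ℕₚ.m+n∸m≡n a (suc b)) ⟩
    signPow a * sumBelow (suc b) (λ i → h (a ℕ.+ suc b) (a ℕ.+ i))
      ≡⟨ cong (signPow a *_) (sumBelow-cong (suc b) (λ i i≤b → h≡g (a ℕ.+ i) (ℕₚ.+-monoʳ-≤ a
           (ℕₚ.≤-pred i≤b)))) ⟩
    signPow a * sumBelow (suc b) (λ i → g (a ℕ.+ i))
      ≡⟨ cong (signPow a *_) (sumBelow-window a (suc b) g
           (ℕₚ.≤-trans (ℕₚ.≤-reflexive (ℕₚ.+-suc a b)) (ℕₚ.≤-trans a+b<M (ℕₚ.n≤1+n M))) below above) ⟨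
    signPow a * sumBelow (suc M) g
      ≡⟨ sumBelow-* (suc M) (signPow a) g ⟨
    sumBelow (suc M) (λ i → signPow a * g i)
      ≡⟨ sumBelow-cong (suc M) (λ i _ → solve 4 (λ s q u v → s :* (q :* (u :* v)) := q :* (s :* (u :* v))) refl
           (signPow a) (q i) (bin i a) (S i)) ⟩
    sumBelow (suc M) (λ i → q i * shiftedTerm i a b) ∎
    where
    open ≡-Reasoning
    S g : ℕ → ℚ
    S i = shift i (bin (M ∸ i)) (a ℕ.+ b)
    g i = q i * (bin i a * S i)

    -- The upper limit is a separate argument `m`, so that a + b + 1 can be replaced by `a + suc b`
    -- in the limit and in the summand at once.
    h : ℕ → ℕ → ℚ
    h m j = bin (M ∸ j) (m ∸ suc j) * bin j a * (B (suc j) ÷! suc j) * (B (suc M ∸ j) ÷! (suc M ∸ j))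

    h≡g : ∀ j → j ≤ a ℕ.+ b → h (a ℕ.+ suc b) j ≡ g j
    h≡g j j≤ = begin
      h (a ℕ.+ suc b) j
        ≡⟨ cong₂ (λ m k → bin (M ∸ j) (m ∸ suc j) * bin j a * (B (suc j) ÷! suc j) * (B k ÷! k))
             (ℕₚ.+-suc a b) (suc-∸ (ℕₚ.≤-trans j≤ (ℕₚ.<⇒≤ a+b<M))) ⟩
      bin (M ∸ j) (a ℕ.+ b ∸ j) * bin j a * (B (suc j) ÷! suc j) * (B (suc (M ∸ j)) ÷! suc (M ∸ j))
        ≡⟨ cong₂ _*_ (cong₂ (λ x y → x * bin j a * y) (sym (shift-≤ j (bin (M ∸ j)) (a ℕ.+ b) j≤)) (B÷!
             (suc j))) (B÷! (suc (M ∸ j))) ⟩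
      S j * bin j a * bernCoeff (suc j) * bernCoeff (suc (M ∸ j))
        ≡⟨ solve 4 (λ s u x y → s :* u :* x :* y := x :* y :* (u :* s))
             refl (S j) (bin j a) (bernCoeff (suc j)) (bernCoeff (suc (M ∸ j))) ⟩
      g j ∎

    below : ∀ i → i < a → g i ≡ 0ℚ
    below i i<a = trans (cong (λ x → q i * (x * S i)) (bin-< i a i<a))
      (solve 2 (λ q u → q :* (con 0ℚ :* u) := con 0ℚ) refl (q i) (S i))

    above : ∀ i → a ℕ.+ suc b ≤ i → i < suc M → g i ≡ 0ℚ
    above i le _ = trans (cong (λ x → q i * (bin i a * x))
        (shift-< i (bin (M ∸ i)) (a ℕ.+ b) (ℕₚ.≤-trans (ℕₚ.≤-reflexive (sym (ℕₚ.+-suc a b))) le)))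
      (solve 2 (λ q u → q :* (u :* con 0ℚ) := con 0ℚ) refl (q i) (bin i a))

  rhs : ℚ
  rhs = (- (fac * (ℕ→ℚ ((N ∸ 1) C (r₁ ℕ.+ r₂ ℕ.+ 1)) + Cyc signedBin r₁ r₂) * (B N ÷! N)))
        - fac * Cyc correction r₁ r₂

  -- The vanishing of `defect r₁ r₂`, multiplied by r₁! r₂! and solved for the sum over
  -- `binProduct`.
  lhs≡rhs : lhs ≡ rhs
  lhs≡rhs = begin
    lhs
      ≡⟨ sumBelow-cong (suc M) (λ i i≤M → summand-suc i (ℕₚ.≤-pred i≤M)) ⟩
    sumBelow (suc M) term
      ≡⟨ sumBelow-* (suc M) fac (λ i → q i * binProduct i r₁ r₂) ⟩
    fac * Σ₀
      ≡⟨ solve 6 (λ f s t u c d → f :* s := f :* (s :+ (t :+ u) :+ c :* d) :- f :* d :* c :- f :* (t :+ u))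
           refl fac Σ₀ Σ₁ Σ₂ cN bins ⟩
    fac * (Σ₀ + (Σ₁ + Σ₂) + cN * bins) - fac * bins * cN - fac * (Σ₁ + Σ₂)
      ≡⟨ cong (λ x → fac * x - fac * bins * cN - fac * (Σ₁ + Σ₂)) (trans (cong (_+ cN * bins)
           (sym sums)) (defect-zero r₁ r₂ r₁+r₂<M)) ⟩
    fac * 0ℚ - fac * bins * cN - fac * (Σ₁ + Σ₂)
      ≡⟨ solve 4 (λ f d c t → f :* con 0ℚ :- f :* d :* c :- f :* t := :- (f :* d :* c) :- f :* t)
           refl fac bins cN (Σ₁ + Σ₂) ⟩
    - (fac * bins * cN) - fac * (Σ₁ + Σ₂)
      ≡⟨ cong₂ (λ x y → - (fac * x * y) - fac * (Σ₁ + Σ₂))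
           (cong (λ m → ℕ→ℚ (suc M C m) + Cyc signedBin r₁ r₂) (ℕₚ.+-comm 1 (r₁ ℕ.+ r₂))) (sym (B÷! N)) ⟩
    - (fac * (ℕ→ℚ (suc M C (r₁ ℕ.+ r₂ ℕ.+ 1)) + Cyc signedBin r₁ r₂) * (B N ÷! N)) - fac * (Σ₁ + Σ₂)
      ≡⟨ cong (λ x → - (fac * (ℕ→ℚ (suc M C (r₁ ℕ.+ r₂ ℕ.+ 1)) + Cyc signedBin r₁ r₂) * (B N ÷! N)) - fac * x)
           (cong₂ _+_ (correction-sum r₁ r₂ r₁+r₂<M)
             (correction-sum r₂ r₁ (ℕₚ.≤-<-trans (ℕₚ.≤-reflexive (ℕₚ.+-comm r₂ r₁)) r₁+r₂<M))) ⟨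
    rhs ∎
    where
    open ≡-Reasoning
    cN bins Σ₀ Σ₁ Σ₂ : ℚ
    cN = bernCoeff N
    bins = total r₁ r₂ + (signedBin r₁ r₂ + signedBin r₂ r₁)
    Σ₀ = sumBelow (suc M) (λ i → q i * binProduct i r₁ r₂)
    Σ₁ = sumBelow (suc M) (λ i → q i * shiftedTerm i r₁ r₂)
    Σ₂ = sumBelow (suc M) (λ i → q i * shiftedTerm i r₂ r₁)

    sums : sumBelow (suc M) (λ i → q i * (binProduct i r₁ r₂ +
         (shiftedTerm i r₁ r₂ + shiftedTerm i r₂ r₁))) ≡ Σ₀ + (Σ₁ + Σ₂)
    sums = trans (sumBelow-cong (suc M) (λ i _ → solve 4 (λ q x y z → q :* (x :+ (y :+ z)) := q :* x :+
         (q :* y :+ q :* z)) refl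
        (q i) (binProduct i r₁ r₂) (shiftedTerm i r₁ r₂) (shiftedTerm i r₂ r₁)))
      (trans (sumBelow-+ (suc M) (λ i → q i * binProduct i r₁ r₂)
           (λ i → q i * shiftedTerm i r₁ r₂ + q i * shiftedTerm i r₂ r₁))
        (cong (λ x → Σ₀ + x) (sumBelow-+ (suc M) (λ i → q i * shiftedTerm i r₁ r₂)
             (λ i → q i * shiftedTerm i r₂ r₁))))

-- For n = k + 2 the product `2 * n` computes to `suc (suc M)` with M the argument of `signPow`
-- here, so this form of M makes the later identification of N with 2n definitional.
signPow-double : ∀ k → signPow (k ℕ.+ suc (suc (k ℕ.+ 0))) ≡ 1ℚ
signPow-double k = begin
  signPow (k ℕ.+ suc (suc (k ℕ.+ 0)))  ≡⟨ signPow-+ k (suc (suc (k ℕ.+ 0))) ⟩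
  signPow k * - - signPow (k ℕ.+ 0)    ≡⟨ cong (λ m → signPow k * - - signPow m) (ℕₚ.+-identityʳ k) ⟩
  signPow k * - - signPow k            ≡⟨ square (signPow-±1 k) ⟩
  1ℚ                                   ∎
  where
  open ≡-Reasoning
  square : ∀ {x} → x ≡ 1ℚ ⊎ x ≡ - 1ℚ → x * - - x ≡ 1ℚ
  square (inj₁ refl) = refl
  square (inj₂ refl) = refl

theorem2p4 : (r₁ r₂ n : ℕ) → r₁ ℕ.+ r₂ ℕ.+ 2 ≤ n →
    let N = 2 ℕ.* n
        summand : ℕ → ℚ
        summand k = (B k ÷! k) * (B (N ∸ k) ÷! (N ∸ k))
                    * prod1To r₁ (λ a → ℤ→ℚ (+ k Data.Integer.- + a))
                    * prod1To r₂ (λ b → ℤ→ℚ (+ (N ∸ k) Data.Integer.- + b))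
        lhs = sumFromTo 1 (N ∸ 1) summand
        mid = sumFromTo (ℕ.suc r₁) (N ∸ r₂ ∸ 1) summand
        fac = ℕ→ℚ (r₁ ! ℕ.* r₂ !)
        binTerm = Cyc (λ s₁ s₂ → signPow s₂ * ℕ→ℚ ((N ∸ 1) C s₁)) r₁ r₂
        sumTerm = Cyc (λ s₁ s₂ → signPow s₁ *
                    sumFromTo (ℕ.suc s₁) (s₁ ℕ.+ s₂ ℕ.+ 1) (λ k →
                      ℕ→ℚ ((N ∸ 1 ∸ k) C (s₁ ℕ.+ s₂ ℕ.+ 1 ∸ k))
                      * ℕ→ℚ ((k ∸ 1) C s₁)
                      * (B k ÷! k) * (B (N ∸ k) ÷! (N ∸ k)))) r₁ r₂
        rhs = (- (fac * (ℕ→ℚ ((N ∸ 1) C (r₁ ℕ.+ r₂ ℕ.+ 1)) + binTerm) * (B N ÷! N)))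
              - fac * sumTerm
    in (lhs ≡ mid) × (mid ≡ rhs)
theorem2p4 r₁ r₂ zero h = contradiction (ℕₚ.m+n≤o⇒n≤o (r₁ ℕ.+ r₂) h) λ ()
theorem2p4 r₁ r₂ (suc zero) h = contradiction (ℕₚ.m+n≤o⇒n≤o (r₁ ℕ.+ r₂) h) λ { (s≤s ()) }
theorem2p4 r₁ r₂ (suc (suc k)) h = lhs≡mid , trans (sym lhs≡mid) lhs≡rhs
  where
  r₁+r₂≤k : r₁ ℕ.+ r₂ ≤ k
  r₁+r₂≤k = ℕₚ.+-cancelʳ-≤ 2 (r₁ ℕ.+ r₂) k (ℕₚ.≤-trans h (ℕₚ.≤-reflexive (ℕₚ.+-comm 2 k)))

  open Summation (k ℕ.+ suc (suc (k ℕ.+ 0))) (signPow-double k) r₁ r₂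
    (ℕₚ.≤-<-trans r₁+r₂≤k (ℕₚ.m<m+n k (s≤s z≤n)))
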